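{- For $n\ge 1$, the reduced regular path homology of the complete graph $K_n$ on $n$ vertices is concentrated in degree $n-1$, where it has rank equal to the number of derangements $D(n)=\sum_{j=0}^{n}(-1)^j\frac{n!}{j!}$.
   Context: $R$ is a fixed nonzero commutative unital ring; rank means rank as a free $R$-module. The complete graph $K_n$ is regarded as the directed graph having both directed edges $(x,y)$ and $(y,x)$ for every pair of distinct vertices $x,y$. A directed graph $G$ has vertex set $V(G)$ and edge set $E(G)\subseteq V(G)\times V(G)$. Regular path homology: let $\Lambda_m(G)$ be the free $R$-module on all $(m+1)$-tuples of vertices, with $\partial=\sum_{i=0}^m(-1)^i(\text{delete the } i\text{ -th entry})$ (and $\partial=0$ for $m=0$). A tuple $(x_0,\dots,x_m)$ is allowed if $(x_i,x_{i+1})\in E(G)$ for all $i$, and strongly regular if its entries are pairwise distinct. Let $\mathcal{A}^\iota_m(G)\subseteq\Lambda_m(G)$ be spanned by the strongly regular allowed tuples, and $\Omega^\iota_m(G)=\{v\in\mathcal{A}^\iota_m(G)\mid \partial v\in\mathcal{A}^\iota_{m-1}(G)\}$ (with $\Omega^\iota_0=\mathcal{A}^\iota_0$). The regular path homology groups are the homology groups of $(\Omega^\iota_*(G),\partial)$; the reduced groups are the homology groups of the complex augmented by $\Omega^\iota_0(G)\to R$, $x\mapsto 1$ for every vertex $x$. -}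

module Defs where

open import Level using (Level; 0ℓ; _⊔_) renaming (suc to lsuc)
open import Algebra.Bundles using (CommutativeMonoid; CommutativeRing)
open import Algebra.Module.Bundles using (LeftModule)
open import Algebra.Module.Morphism.Structures using (module LeftModuleMorphisms)
import Algebra.Module.Construct.TensorUnit as TensorUnit
import Algebra.Module.Construct.Zero as ZeroModule
import Algebra.Properties.AbelianGroup as AbelianGroupProperties
import Algebra.Properties.CommutativeSemigroup as CommutativeSemigroupProperties
import Algebra.Properties.Monoid.Sum as MonoidSum
import Algebra.Properties.Semiring.Exp as SemiringExp
import Data.Fin.Permutation as Permutation
open import Data.Fin.Base using (Fin; zero; suc; toℕ)
open import Data.Integer.Base as ℤ using (ℤ; +_; -[1+_]; -1ℤ)
open import Data.Integer.Properties using (+-0-monoid)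
open import Data.Nat.Base using (ℕ; zero; suc; _!)
open import Data.Nat.DivMod using (_/_)
open import Data.Nat.Properties using (_!≢0)
open import Data.Product.Base using (Σ; ∃; _×_; _,_; proj₁; proj₂)
open import Data.Vec.Base using (Vec; []; _∷_; removeAt)
open import Data.Vec.Functional using (Vector)
open import Data.Vec.Relation.Unary.Linked using (Linked)
open import Data.Vec.Relation.Unary.Unique.Propositional using (Unique)
open import Relation.Binary.Bundles using (Setoid)
open import Relation.Binary.Core using (Rel)
open import Relation.Binary.PropositionalEquality.Core using (_≡_; _≢_; refl; sym; trans)
open import Relation.Unary using (Pred; _∈_)
import Relation.Binary.Reasoning.Setoid as SetoidReasoning

Derangements : ℕ → Setoid 0ℓ 0ℓ
Derangements n = record
  { Carrier       = Σ (Permutation.Permutation′ n) λ π → ∀ i → π Permutation.⟨$⟩ʳ i ≢ i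
  ; _≈_           = λ (π , _) (ρ , _) → π Permutation.≈ ρ
  ; isEquivalence = record
    { refl  = λ _ → refl
    ; sym   = λ p i → sym (p i)
    ; trans = λ p q i → trans (p i) (q i)
    }
  }

-- The natural-number division is exact, as j ≤ n.
D : ℕ → ℤ
D n = ∑[ j ≤ n ] ((-1ℤ ℤ.^ toℕ j) ℤ.* (+ (_/_ (n !) (toℕ j !) {{toℕ j !≢0}})))
  where open MonoidSum +-0-monoid using (sum⁺-syntax)

record Digraph : Set₁ where
  field
    V : Set
    E : Rel V 0ℓ

complete : ℕ → Digraph
complete n = record { V = Fin n ; E = _≢_ }

module _ (G : Digraph) where
  open Digraph G

  Allowed : ∀ {k} → Vec V k → Set
  Allowed = Linked E

  StronglyRegular : ∀ {k} → Vec V k → Set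
  StronglyRegular = Unique

-- Since R is commutative, R-modules are represented by left R-modules.

module Modules {c ℓ : Level} (R : CommutativeRing c ℓ) where

  open CommutativeRing R
    using (Carrier; _≈_; _+_; _*_; -_; 0#; 1#; ring; semiring)
  private module R = CommutativeRing R

  IsZero : ∀ {m ℓm} → LeftModule ring m ℓm → Set (m ⊔ ℓm)
  IsZero M = ∀ x → x ≈ᴹ 0ᴹ
    where open LeftModule M

  record IsBasis {m ℓm} (M : LeftModule ring m ℓm) {r : ℕ}
                 (b : Vector (LeftModule.Carrierᴹ M) r) : Set (c ⊔ ℓ ⊔ m ⊔ ℓm) where
    open LeftModule M
    open MonoidSum +ᴹ-monoid using (sum-syntax)
    field
      spanning    : ∀ x → ∃ λ (a : Vector Carrier r) → x ≈ᴹ ∑[ i < r ] (a i *ₗ b i)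
      independent : ∀ (a : Vector Carrier r) →
                    ∑[ i < r ] (a i *ₗ b i) ≈ᴹ 0ᴹ → ∀ i → a i ≈ 0#

  IsFreeOfRank : ∀ {m ℓm} → LeftModule ring m ℓm → ℕ → Set (c ⊔ ℓ ⊔ m ⊔ ℓm)
  IsFreeOfRank M r = ∃ λ (b : Vector (LeftModule.Carrierᴹ M) r) → IsBasis M b

  module ModuleProperties {m ℓm} (M : LeftModule ring m ℓm) where
    open LeftModule M
    open AbelianGroupProperties +ᴹ-abelianGroup public
      using () renaming (inverseˡ-unique to -ᴹ-uniqueˡ; ⁻¹-∙-comm to -ᴹ-+ᴹ-comm;
                         ⁻¹-involutive to -ᴹ-involutive; ε⁻¹≈ε to -ᴹ0≈0)
    open CommutativeSemigroupProperties
      (CommutativeMonoid.commutativeSemigroup +ᴹ-commutativeMonoid) public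
      using () renaming (interchange to +ᴹ-interchange)
    open SetoidReasoning ≈ᴹ-setoid

    -1*≈- : ∀ x → (- 1#) *ₗ x ≈ᴹ -ᴹ x
    -1*≈- x = -ᴹ-uniqueˡ _ _ (begin
      (- 1#) *ₗ x +ᴹ x            ≈⟨ +ᴹ-congˡ (≈ᴹ-sym (*ₗ-identityˡ x)) ⟩
      (- 1#) *ₗ x +ᴹ 1# *ₗ x      ≈⟨ ≈ᴹ-sym (*ₗ-distribʳ x (- 1#) 1#) ⟩
      (- 1# + 1#) *ₗ x            ≈⟨ *ₗ-cong (R.-‿inverseˡ 1#) ≈ᴹ-refl ⟩
      0# *ₗ x                     ≈⟨ *ₗ-zeroˡ x ⟩
      0ᴹ                          ∎)

    *-neg : ∀ r x → r *ₗ (-ᴹ x) ≈ᴹ -ᴹ (r *ₗ x)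
    *-neg r x = -ᴹ-uniqueˡ _ _ (begin
      r *ₗ (-ᴹ x) +ᴹ r *ₗ x       ≈⟨ ≈ᴹ-sym (*ₗ-distribˡ r (-ᴹ x) x) ⟩
      r *ₗ (-ᴹ x +ᴹ x)            ≈⟨ *ₗ-cong R.refl (-ᴹ‿inverseˡ x) ⟩
      r *ₗ 0ᴹ                     ≈⟨ *ₗ-zeroʳ r ⟩
      0ᴹ                          ∎)

  record LinearMap {m ℓm n ℓn} (M : LeftModule ring m ℓm) (N : LeftModule ring n ℓn)
                   : Set (c ⊔ m ⊔ ℓm ⊔ n ⊔ ℓn) where
    private
      module M = LeftModule M
      module N = LeftModule N
    field
      ⟦_⟧   : M.Carrierᴹ → N.Carrierᴹ
      cong  : ∀ {x y} → x M.≈ᴹ y → ⟦ x ⟧ N.≈ᴹ ⟦ y ⟧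
      +-hom : ∀ x y → ⟦ x M.+ᴹ y ⟧ N.≈ᴹ ⟦ x ⟧ N.+ᴹ ⟦ y ⟧
      *-hom : ∀ r x → ⟦ r M.*ₗ x ⟧ N.≈ᴹ r N.*ₗ ⟦ x ⟧

    0-hom : ⟦ M.0ᴹ ⟧ N.≈ᴹ N.0ᴹ
    0-hom = N.≈ᴹ-trans (cong (M.≈ᴹ-sym (M.*ₗ-zeroˡ M.0ᴹ)))
              (N.≈ᴹ-trans (*-hom 0# M.0ᴹ) (N.*ₗ-zeroˡ _))

    neg-hom : ∀ x → ⟦ M.-ᴹ x ⟧ N.≈ᴹ N.-ᴹ ⟦ x ⟧
    neg-hom x = N.≈ᴹ-trans (cong (M.≈ᴹ-sym (ModuleProperties.-1*≈- M x)))
                  (N.≈ᴹ-trans (*-hom (- 1#) x) (ModuleProperties.-1*≈- N ⟦ x ⟧))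

    isLeftModuleHomomorphism :
      LeftModuleMorphisms.IsLeftModuleHomomorphism M.rawLeftModule N.rawLeftModule ⟦_⟧
    isLeftModuleHomomorphism = record
      { +ᴹ-isGroupHomomorphism = record
        { isMonoidHomomorphism = record
          { isMagmaHomomorphism = record
            { isRelHomomorphism = record { cong = cong }
            ; homo              = +-hom
            }
          ; ε-homo = 0-hom
          }
        ; ⁻¹-homo = neg-hom
        }
      ; *ₗ-homo = *-hom
      }

  record Submodule {m ℓm} (M : LeftModule ring m ℓm) (p : Level)
                   : Set (c ⊔ m ⊔ ℓm ⊔ lsuc p) where
    open LeftModule M
    field
      Member : Pred Carrierᴹ p
      resp   : ∀ {x y} → x ≈ᴹ y → x ∈ Member → y ∈ Member
      0∈     : 0ᴹ ∈ Member
      +∈     : ∀ {x y} → x ∈ Member → y ∈ Member → x +ᴹ y ∈ Member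
      *∈     : ∀ r {x} → x ∈ Member → r *ₗ x ∈ Member

    neg∈ : ∀ {x} → x ∈ Member → -ᴹ x ∈ Member
    neg∈ {x} x∈ = resp (ModuleProperties.-1*≈- M x) (*∈ (- 1#) x∈)

  module _ {m ℓm p} {M : LeftModule ring m ℓm} (S : Submodule M p) where
    open LeftModule M
    open Submodule S

    ⟨_⟩ : LeftModule ring (m ⊔ p) ℓm
    ⟨_⟩ = record
      { Carrierᴹ     = Σ Carrierᴹ Member
      ; _≈ᴹ_         = λ (x , _) (y , _) → x ≈ᴹ y
      ; _+ᴹ_         = λ (x , x∈) (y , y∈) → x +ᴹ y , +∈ x∈ y∈
      ; _*ₗ_         = λ r (x , x∈) → r *ₗ x , *∈ r x∈
      ; 0ᴹ           = 0ᴹ , 0∈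
      ; -ᴹ_          = λ (x , x∈) → -ᴹ x , neg∈ x∈
      ; isLeftModule = record
        { isLeftSemimodule = record
          { +ᴹ-isCommutativeMonoid = record
            { isMonoid = record
              { isSemigroup = record
                { isMagma = record
                  { isEquivalence = record
                    { refl = ≈ᴹ-refl ; sym = ≈ᴹ-sym ; trans = ≈ᴹ-trans }
                  ; ∙-cong = +ᴹ-cong
                  }
                ; assoc = λ _ _ _ → +ᴹ-assoc _ _ _
                }
              ; identity = (λ _ → +ᴹ-identityˡ _) , (λ _ → +ᴹ-identityʳ _)
              }
            ; comm = λ _ _ → +ᴹ-comm _ _
            }
          ; isPreleftSemimodule = record
            { *ₗ-cong      = *ₗ-cong
            ; *ₗ-zeroˡ     = λ _ → *ₗ-zeroˡ _
            ; *ₗ-distribʳ  = λ _ _ _ → *ₗ-distribʳ _ _ _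
            ; *ₗ-identityˡ = λ _ → *ₗ-identityˡ _
            ; *ₗ-assoc     = λ _ _ _ → *ₗ-assoc _ _ _
            ; *ₗ-zeroʳ     = λ _ → *ₗ-zeroʳ _
            ; *ₗ-distribˡ  = λ _ _ _ → *ₗ-distribˡ _ _ _
            }
          }
        ; -ᴹ‿cong    = -ᴹ‿cong
        ; -ᴹ‿inverse = (λ _ → -ᴹ‿inverseˡ _) , (λ _ → -ᴹ‿inverseʳ _)
        }
      }

  module _ {m ℓm p} (M : LeftModule ring m ℓm) (S : Submodule M p) where
    open LeftModule M
    open Submodule S
    open ModuleProperties M
    open SetoidReasoning ≈ᴹ-setoid

    private
      _∼_ : Rel Carrierᴹ p
      x ∼ y = x +ᴹ (-ᴹ y) ∈ Member

      ≈⇒∼ : ∀ {x y} → x ≈ᴹ y → x ∼ y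
      ≈⇒∼ {x} {y} x≈y = resp (begin
        0ᴹ            ≈⟨ ≈ᴹ-sym (-ᴹ‿inverseʳ y) ⟩
        y +ᴹ (-ᴹ y)   ≈⟨ +ᴹ-congʳ (≈ᴹ-sym x≈y) ⟩
        x +ᴹ (-ᴹ y)   ∎) 0∈

      ∼-sym : ∀ {x y} → x ∼ y → y ∼ x
      ∼-sym {x} {y} x∼y = resp (begin
        -ᴹ (x +ᴹ (-ᴹ y))          ≈⟨ ≈ᴹ-sym (-ᴹ-+ᴹ-comm x (-ᴹ y)) ⟩
        (-ᴹ x) +ᴹ (-ᴹ (-ᴹ y))     ≈⟨ +ᴹ-congˡ (-ᴹ-involutive y) ⟩
        (-ᴹ x) +ᴹ y               ≈⟨ +ᴹ-comm (-ᴹ x) y ⟩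
        y +ᴹ (-ᴹ x)               ∎) (neg∈ x∼y)

      ∼-trans : ∀ {x y z} → x ∼ y → y ∼ z → x ∼ z
      ∼-trans {x} {y} {z} x∼y y∼z = resp (begin
        (x +ᴹ (-ᴹ y)) +ᴹ (y +ᴹ (-ᴹ z))   ≈⟨ +ᴹ-assoc x (-ᴹ y) _ ⟩
        x +ᴹ ((-ᴹ y) +ᴹ (y +ᴹ (-ᴹ z)))   ≈⟨ +ᴹ-congˡ (≈ᴹ-sym (+ᴹ-assoc (-ᴹ y) y (-ᴹ z))) ⟩
        x +ᴹ (((-ᴹ y) +ᴹ y) +ᴹ (-ᴹ z))   ≈⟨ +ᴹ-congˡ (+ᴹ-congʳ (-ᴹ‿inverseˡ y)) ⟩
        x +ᴹ (0ᴹ +ᴹ (-ᴹ z))              ≈⟨ +ᴹ-congˡ (+ᴹ-identityˡ (-ᴹ z)) ⟩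
        x +ᴹ (-ᴹ z)                      ∎) (+∈ x∼y y∼z)

      +-∼ : ∀ {x y u v} → x ∼ y → u ∼ v → (x +ᴹ u) ∼ (y +ᴹ v)
      +-∼ {x} {y} {u} {v} x∼y u∼v = resp (begin
        (x +ᴹ (-ᴹ y)) +ᴹ (u +ᴹ (-ᴹ v))   ≈⟨ +ᴹ-interchange x (-ᴹ y) u (-ᴹ v) ⟩
        (x +ᴹ u) +ᴹ ((-ᴹ y) +ᴹ (-ᴹ v))   ≈⟨ +ᴹ-congˡ (-ᴹ-+ᴹ-comm y v) ⟩
        (x +ᴹ u) +ᴹ (-ᴹ (y +ᴹ v))        ∎) (+∈ x∼y u∼v)

      *-∼ : ∀ {r s x y} → r ≈ s → x ∼ y → (r *ₗ x) ∼ (s *ₗ y)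
      *-∼ {r} {s} {x} {y} r≈s x∼y = resp (begin
        r *ₗ (x +ᴹ (-ᴹ y))               ≈⟨ *ₗ-distribˡ r x (-ᴹ y) ⟩
        (r *ₗ x) +ᴹ (r *ₗ (-ᴹ y))        ≈⟨ +ᴹ-congˡ (*-neg r y) ⟩
        (r *ₗ x) +ᴹ (-ᴹ (r *ₗ y))        ≈⟨ +ᴹ-congˡ (-ᴹ‿cong (*ₗ-cong r≈s ≈ᴹ-refl)) ⟩
        (r *ₗ x) +ᴹ (-ᴹ (s *ₗ y))        ∎) (*∈ r x∼y)

      neg-∼ : ∀ {x y} → x ∼ y → (-ᴹ x) ∼ (-ᴹ y)
      neg-∼ {x} {y} x∼y = resp (≈ᴹ-sym (-ᴹ-+ᴹ-comm x (-ᴹ y))) (neg∈ x∼y)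

    Quotient : LeftModule ring m p
    Quotient = record
      { Carrierᴹ     = Carrierᴹ
      ; _≈ᴹ_         = _∼_
      ; _+ᴹ_         = _+ᴹ_
      ; _*ₗ_         = _*ₗ_
      ; 0ᴹ           = 0ᴹ
      ; -ᴹ_          = -ᴹ_
      ; isLeftModule = record
        { isLeftSemimodule = record
          { +ᴹ-isCommutativeMonoid = record
            { isMonoid = record
              { isSemigroup = record
                { isMagma = record
                  { isEquivalence = record
                    { refl = ≈⇒∼ ≈ᴹ-refl ; sym = ∼-sym ; trans = ∼-trans }
                  ; ∙-cong = +-∼
                  }
                ; assoc = λ x y z → ≈⇒∼ (+ᴹ-assoc x y z)
                }
              ; identity = (λ x → ≈⇒∼ (+ᴹ-identityˡ x)) , (λ x → ≈⇒∼ (+ᴹ-identityʳ x))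
              }
            ; comm = λ x y → ≈⇒∼ (+ᴹ-comm x y)
            }
          ; isPreleftSemimodule = record
            { *ₗ-cong      = *-∼
            ; *ₗ-zeroˡ     = λ x → ≈⇒∼ (*ₗ-zeroˡ x)
            ; *ₗ-distribʳ  = λ x r s → ≈⇒∼ (*ₗ-distribʳ x r s)
            ; *ₗ-identityˡ = λ x → ≈⇒∼ (*ₗ-identityˡ x)
            ; *ₗ-assoc     = λ r s x → ≈⇒∼ (*ₗ-assoc r s x)
            ; *ₗ-zeroʳ     = λ r → ≈⇒∼ (*ₗ-zeroʳ r)
            ; *ₗ-distribˡ  = λ r x y → ≈⇒∼ (*ₗ-distribˡ r x y)
            }
          }
        ; -ᴹ‿cong    = neg-∼
        ; -ᴹ‿inverse = (λ x → ≈⇒∼ (-ᴹ‿inverseˡ x)) , (λ x → ≈⇒∼ (-ᴹ‿inverseʳ x))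
        }
      }

  module _ {m ℓm n ℓn} {M : LeftModule ring m ℓm} {N : LeftModule ring n ℓn}
           (f : LinearMap M N) where
    private
      module M = LeftModule M
      module N = LeftModule N
    open LinearMap f

    Kernel : Submodule M ℓn
    Kernel = record
      { Member = λ x → ⟦ x ⟧ N.≈ᴹ N.0ᴹ
      ; resp   = λ x≈y fx≈0 → N.≈ᴹ-trans (cong (M.≈ᴹ-sym x≈y)) fx≈0
      ; 0∈     = 0-hom
      ; +∈     = λ p q → N.≈ᴹ-trans (+-hom _ _)
                           (N.≈ᴹ-trans (N.+ᴹ-cong p q) (N.+ᴹ-identityˡ N.0ᴹ))
      ; *∈     = λ r p → N.≈ᴹ-trans (*-hom r _)
                           (N.≈ᴹ-trans (N.*ₗ-cong R.refl p) (N.*ₗ-zeroʳ r))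
      }

    Image : Submodule N (m ⊔ ℓn)
    Image = record
      { Member = λ y → ∃ λ x → y N.≈ᴹ ⟦ x ⟧
      ; resp   = λ y≈z (x , y≈fx) → x , N.≈ᴹ-trans (N.≈ᴹ-sym y≈z) y≈fx
      ; 0∈     = M.0ᴹ , N.≈ᴹ-sym 0-hom
      ; +∈     = λ (x , p) (y , q) → x M.+ᴹ y ,
                   N.≈ᴹ-trans (N.+ᴹ-cong p q) (N.≈ᴹ-sym (+-hom x y))
      ; *∈     = λ r (x , p) → r M.*ₗ x ,
                   N.≈ᴹ-trans (N.*ₗ-cong R.refl p) (N.≈ᴹ-sym (*-hom r x))
      }

    Preimage : ∀ {p} → Submodule N p → Submodule M p
    Preimage S = record
      { Member = λ x → ⟦ x ⟧ ∈ Member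
      ; resp   = λ x≈y → resp (cong x≈y)
      ; 0∈     = resp (N.≈ᴹ-sym 0-hom) 0∈
      ; +∈     = λ p q → resp (N.≈ᴹ-sym (+-hom _ _)) (+∈ p q)
      ; *∈     = λ r p → resp (N.≈ᴹ-sym (*-hom r _)) (*∈ r p)
      }
      where open Submodule S

    restrict : ∀ {p q} (S : Submodule M p) (T : Submodule N q) →
               (∀ {x} → x ∈ Submodule.Member S → ⟦ x ⟧ ∈ Submodule.Member T) →
               LinearMap ⟨ S ⟩ ⟨ T ⟩
    restrict S T f∈ = record
      { ⟦_⟧   = λ (x , x∈) → ⟦ x ⟧ , f∈ x∈
      ; cong  = cong
      ; +-hom = λ _ _ → +-hom _ _
      ; *-hom = λ r _ → *-hom r _
      }

    corestrict : ∀ {q} (T : Submodule N q) → (∀ x → ⟦ x ⟧ ∈ Submodule.Member T) →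
                 LinearMap M ⟨ T ⟩
    corestrict T f∈ = record
      { ⟦_⟧ = λ x → ⟦ x ⟧ , f∈ x ; cong = cong ; +-hom = +-hom ; *-hom = *-hom }

    domRestrict : ∀ {p} (S : Submodule M p) → LinearMap ⟨ S ⟩ N
    domRestrict S = record
      { ⟦_⟧   = λ (x , _) → ⟦ x ⟧
      ; cong  = cong
      ; +-hom = λ _ _ → +-hom _ _
      ; *-hom = λ r _ → *-hom r _
      }

  _∩_ : ∀ {m ℓm p q} {M : LeftModule ring m ℓm} →
        Submodule M p → Submodule M q → Submodule M (p ⊔ q)
  S ∩ T = record
    { Member = λ x → x ∈ S.Member × x ∈ T.Member
    ; resp   = λ e (s , t) → S.resp e s , T.resp e t
    ; 0∈     = S.0∈ , T.0∈
    ; +∈     = λ (s , t) (s′ , t′) → S.+∈ s s′ , T.+∈ t t′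
    ; *∈     = λ r (s , t) → S.*∈ r s , T.*∈ r t
    }
    where
    module S = Submodule S
    module T = Submodule T

  module _ {m ℓm i} (M : LeftModule ring m ℓm) {I : Set i}
           (g : I → LeftModule.Carrierᴹ M) where
    open LeftModule M

    data InSpan : Pred Carrierᴹ (c ⊔ m ⊔ ℓm ⊔ i) where
      span-gen  : ∀ j → g j ∈ InSpan
      span-resp : ∀ {x y} → x ≈ᴹ y → x ∈ InSpan → y ∈ InSpan
      span-0    : 0ᴹ ∈ InSpan
      span-+    : ∀ {x y} → x ∈ InSpan → y ∈ InSpan → x +ᴹ y ∈ InSpan
      span-*    : ∀ r {x} → x ∈ InSpan → r *ₗ x ∈ InSpan

    Span : Submodule M (c ⊔ m ⊔ ℓm ⊔ i)
    Span = record
      { Member = InSpan ; resp = span-resp ; 0∈ = span-0 ; +∈ = span-+ ; *∈ = span-* }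

  -- Ker g / Im f for  L --f--> M --g--> N  with  g ∘ f = 0.
  Homology : ∀ {l ℓl m ℓm n ℓn}
    {L : LeftModule ring l ℓl} {M : LeftModule ring m ℓm} {N : LeftModule ring n ℓn}
    (f : LinearMap L M) (g : LinearMap M N) →
    (∀ x → LeftModule._≈ᴹ_ N (LinearMap.⟦_⟧ g (LinearMap.⟦_⟧ f x)) (LeftModule.0ᴹ N)) →
    LeftModule ring (m ⊔ ℓn) (l ⊔ ℓm)
  Homology f g gf≈0 =
    Quotient ⟨ Kernel g ⟩ (Image (corestrict f (Kernel g) gf≈0))

  zeroMap : ∀ {m ℓm n ℓn} (M : LeftModule ring m ℓm) (N : LeftModule ring n ℓn) →
            LinearMap M N
  zeroMap M N = record
    { ⟦_⟧   = λ _ → 0ᴹ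
    ; cong  = λ _ → ≈ᴹ-refl
    ; +-hom = λ _ _ → ≈ᴹ-sym (+ᴹ-identityˡ 0ᴹ)
    ; *-hom = λ r _ → ≈ᴹ-sym (*ₗ-zeroʳ r)
    }
    where open LeftModule N

  -- The free R-module on a set X: formal expressions over X, modulo the
  -- congruence generated by the module laws.

  module FreeModule (X : Set) where

    infixl 6 _⊕_
    infixr 7 _⊙_
    infix  4 _≋_

    data Term : Set c where
      η   : X → Term
      𝟘   : Term
      _⊕_ : Term → Term → Term
      ⊝_  : Term → Term
      _⊙_ : Carrier → Term → Term

    data _≋_ : Rel Term (c ⊔ ℓ) where
      ≋-refl    : ∀ {x} → x ≋ x
      ≋-sym     : ∀ {x y} → x ≋ y → y ≋ x
      ≋-trans   : ∀ {x y z} → x ≋ y → y ≋ z → x ≋ z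
      ⊕-cong    : ∀ {x y u v} → x ≋ y → u ≋ v → x ⊕ u ≋ y ⊕ v
      ⊝-cong    : ∀ {x y} → x ≋ y → ⊝ x ≋ ⊝ y
      ⊙-cong    : ∀ {r s x y} → r ≈ s → x ≋ y → r ⊙ x ≋ s ⊙ y
      ⊕-assoc   : ∀ x y z → (x ⊕ y) ⊕ z ≋ x ⊕ (y ⊕ z)
      ⊕-comm    : ∀ x y → x ⊕ y ≋ y ⊕ x
      ⊕-idˡ     : ∀ x → 𝟘 ⊕ x ≋ x
      ⊕-invˡ    : ∀ x → (⊝ x) ⊕ x ≋ 𝟘
      ⊙-zeroˡ   : ∀ x → 0# ⊙ x ≋ 𝟘
      ⊙-zeroʳ   : ∀ r → r ⊙ 𝟘 ≋ 𝟘
      ⊙-distʳ   : ∀ x r s → (r + s) ⊙ x ≋ r ⊙ x ⊕ s ⊙ x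
      ⊙-distˡ   : ∀ r x y → r ⊙ (x ⊕ y) ≋ r ⊙ x ⊕ r ⊙ y
      ⊙-idˡ     : ∀ x → 1# ⊙ x ≋ x
      ⊙-assoc   : ∀ r s x → (r * s) ⊙ x ≋ r ⊙ (s ⊙ x)

    Free : LeftModule ring c (c ⊔ ℓ)
    Free = record
      { Carrierᴹ     = Term
      ; _≈ᴹ_         = _≋_
      ; _+ᴹ_         = _⊕_
      ; _*ₗ_         = _⊙_
      ; 0ᴹ           = 𝟘
      ; -ᴹ_          = ⊝_
      ; isLeftModule = record
        { isLeftSemimodule = record
          { +ᴹ-isCommutativeMonoid = record
            { isMonoid = record
              { isSemigroup = record
                { isMagma = record
                  { isEquivalence = record
                    { refl = ≋-refl ; sym = ≋-sym ; trans = ≋-trans }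
                  ; ∙-cong = ⊕-cong
                  }
                ; assoc = ⊕-assoc
                }
              ; identity = ⊕-idˡ , λ x → ≋-trans (⊕-comm x 𝟘) (⊕-idˡ x)
              }
            ; comm = ⊕-comm
            }
          ; isPreleftSemimodule = record
            { *ₗ-cong      = ⊙-cong
            ; *ₗ-zeroˡ     = ⊙-zeroˡ
            ; *ₗ-distribʳ  = ⊙-distʳ
            ; *ₗ-identityˡ = ⊙-idˡ
            ; *ₗ-assoc     = ⊙-assoc
            ; *ₗ-zeroʳ     = ⊙-zeroʳ
            ; *ₗ-distribˡ  = ⊙-distˡ
            }
          }
        ; -ᴹ‿cong    = ⊝-cong
        ; -ᴹ‿inverse = ⊕-invˡ , λ x → ≋-trans (⊕-comm x (⊝ x)) (⊕-invˡ x)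
        }
      }

    module _ {n ℓn} (N : LeftModule ring n ℓn) (h : X → LeftModule.Carrierᴹ N) where
      open LeftModule N

      extendFun : Term → Carrierᴹ
      extendFun (η x)   = h x
      extendFun 𝟘       = 0ᴹ
      extendFun (x ⊕ y) = extendFun x +ᴹ extendFun y
      extendFun (⊝ x)   = -ᴹ extendFun x
      extendFun (r ⊙ x) = r *ₗ extendFun x

      extendCong : ∀ {x y} → x ≋ y → extendFun x ≈ᴹ extendFun y
      extendCong ≋-refl          = ≈ᴹ-refl
      extendCong (≋-sym p)       = ≈ᴹ-sym (extendCong p)
      extendCong (≋-trans p q)   = ≈ᴹ-trans (extendCong p) (extendCong q)
      extendCong (⊕-cong p q)    = +ᴹ-cong (extendCong p) (extendCong q)
      extendCong (⊝-cong p)      = -ᴹ‿cong (extendCong p)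
      extendCong (⊙-cong r≈s p)  = *ₗ-cong r≈s (extendCong p)
      extendCong (⊕-assoc _ _ _) = +ᴹ-assoc _ _ _
      extendCong (⊕-comm _ _)    = +ᴹ-comm _ _
      extendCong (⊕-idˡ _)       = +ᴹ-identityˡ _
      extendCong (⊕-invˡ _)      = -ᴹ‿inverseˡ _
      extendCong (⊙-zeroˡ _)     = *ₗ-zeroˡ _
      extendCong (⊙-zeroʳ r)     = *ₗ-zeroʳ r
      extendCong (⊙-distʳ _ r s) = *ₗ-distribʳ _ r s
      extendCong (⊙-distˡ r _ _) = *ₗ-distribˡ r _ _
      extendCong (⊙-idˡ _)       = *ₗ-identityˡ _
      extendCong (⊙-assoc r s _) = *ₗ-assoc r s _

      extend : LinearMap Free N
      extend = record
        { ⟦_⟧   = extendFun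
        ; cong  = extendCong
        ; +-hom = λ _ _ → ≈ᴹ-refl
        ; *-hom = λ _ _ → ≈ᴹ-refl
        }

    module _ {n ℓn} {N : LeftModule ring n ℓn} (f g : LinearMap Free N) where
      open LeftModule N
      private
        module f = LinearMap f
        module g = LinearMap g

      ext : (∀ x → f.⟦ η x ⟧ ≈ᴹ g.⟦ η x ⟧) → ∀ t → f.⟦ t ⟧ ≈ᴹ g.⟦ t ⟧
      ext e (η x)   = e x
      ext e 𝟘       = ≈ᴹ-trans f.0-hom (≈ᴹ-sym g.0-hom)
      ext e (s ⊕ t) = ≈ᴹ-trans (f.+-hom s t)
                        (≈ᴹ-trans (+ᴹ-cong (ext e s) (ext e t)) (≈ᴹ-sym (g.+-hom s t)))
      ext e (⊝ t)   = ≈ᴹ-trans (f.neg-hom t)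
                        (≈ᴹ-trans (-ᴹ‿cong (ext e t)) (≈ᴹ-sym (g.neg-hom t)))
      ext e (r ⊙ t) = ≈ᴹ-trans (f.*-hom r t)
                        (≈ᴹ-trans (*ₗ-cong R.refl (ext e t)) (≈ᴹ-sym (g.*-hom r t)))

  open FreeModule public using (Free; η; extend; ext)

  _∘ₗ_ : ∀ {l ℓl m ℓm n ℓn}
    {L : LeftModule ring l ℓl} {M : LeftModule ring m ℓm} {N : LeftModule ring n ℓn} →
    LinearMap M N → LinearMap L M → LinearMap L N
  _∘ₗ_ {N = N} g f = record
    { ⟦_⟧   = λ x → g.⟦ f.⟦ x ⟧ ⟧
    ; cong  = λ p → g.cong (f.cong p)
    ; +-hom = λ x y → ≈ᴹ-trans (g.cong (f.+-hom x y)) (g.+-hom _ _)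
    ; *-hom = λ r x → ≈ᴹ-trans (g.cong (f.*-hom r x)) (g.*-hom r _)
    }
    where
    open LeftModule N
    module f = LinearMap f
    module g = LinearMap g

  module Tuples (V : Set) where

    -- Indexed by the length of the tuples, which is the degree plus one.  The
    -- case of length 0 serves only to prove  delete² .
    Chains : ℕ → LeftModule ring c (c ⊔ ℓ)
    Chains k = Free (Vec V k)

    delete : ∀ k → LinearMap (Chains (suc k)) (Chains k)
    delete k = extend (Vec V (suc k)) (Chains k) λ x →
        ∑[ i ≤ k ] (((- 1#) ^ toℕ i) *ₗ η (removeAt x i))
      where
      open LeftModule (Chains k)
      open MonoidSum +ᴹ-monoid using (sum⁺-syntax)
      open SemiringExp semiring using (_^_)

    private
      open SemiringExp semiring using (_^_)

      infixl 8 _$_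
      _$_ : ∀ {m ℓm n ℓn} {M : LeftModule ring m ℓm} {N : LeftModule ring n ℓn} →
            LinearMap M N → LeftModule.Carrierᴹ M → LeftModule.Carrierᴹ N
      _$_ = LinearMap.⟦_⟧

      sum-hom : ∀ {m ℓm n ℓn} {M : LeftModule ring m ℓm} {N : LeftModule ring n ℓn}
        (f : LinearMap M N) k (x : Vector (LeftModule.Carrierᴹ M) k)
        (y : Vector (LeftModule.Carrierᴹ N) k) →
        (∀ i → LeftModule._≈ᴹ_ N (f $ x i) (y i)) →
        LeftModule._≈ᴹ_ N (f $ MonoidSum.sum (LeftModule.+ᴹ-monoid M) x)
                          (MonoidSum.sum (LeftModule.+ᴹ-monoid N) y)
      sum-hom f zero x y p = LinearMap.0-hom f
      sum-hom {N = N} f (suc k) x y p =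
        ≈ᴹ-trans (LinearMap.+-hom f _ _)
          (+ᴹ-cong (p zero) (sum-hom f k _ _ λ i → p (suc i)))
        where open LeftModule N

      cone : ∀ k → V → LinearMap (Chains k) (Chains (suc k))
      cone k v = extend (Vec V k) (Chains (suc k)) λ x → η (v ∷ x)

      infixl 6 _⊞_
      _⊞_ : ∀ {m ℓm n ℓn} {M : LeftModule ring m ℓm} {N : LeftModule ring n ℓn} →
            LinearMap M N → LinearMap M N → LinearMap M N
      _⊞_ {N = N} f g = record
        { ⟦_⟧   = λ x → f.⟦ x ⟧ +ᴹ g.⟦ x ⟧
        ; cong  = λ p → +ᴹ-cong (f.cong p) (g.cong p)
        ; +-hom = λ x y → ≈ᴹ-trans (+ᴹ-cong (f.+-hom x y) (g.+-hom x y))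
                            (ModuleProperties.+ᴹ-interchange N _ _ _ _)
        ; *-hom = λ r x → ≈ᴹ-trans (+ᴹ-cong (f.*-hom r x) (g.*-hom r x))
                            (≈ᴹ-sym (*ₗ-distribˡ r _ _))
        }
        where
        open LeftModule N
        module f = LinearMap f
        module g = LinearMap g

      negate : ∀ {m ℓm n ℓn} {M : LeftModule ring m ℓm} {N : LeftModule ring n ℓn} →
               LinearMap M N → LinearMap M N
      negate {N = N} f = record
        { ⟦_⟧   = λ x → -ᴹ f.⟦ x ⟧
        ; cong  = λ p → -ᴹ‿cong (f.cong p)
        ; +-hom = λ x y → ≈ᴹ-trans (-ᴹ‿cong (f.+-hom x y)) (≈ᴹ-sym (-ᴹ-+ᴹ-comm _ _))
        ; *-hom = λ r x → ≈ᴹ-trans (-ᴹ‿cong (f.*-hom r x)) (≈ᴹ-sym (*-neg r _))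
        }
        where
        open LeftModule N
        open ModuleProperties N
        module f = LinearMap f

      idₗ : ∀ {m ℓm} {M : LeftModule ring m ℓm} → LinearMap M M
      idₗ {M = M} = record
        { ⟦_⟧ = λ x → x ; cong = λ p → p ; +-hom = λ _ _ → ≈ᴹ-refl ; *-hom = λ _ _ → ≈ᴹ-refl }
        where open LeftModule M

      delete-cons : ∀ k v (x : Vec V (suc k)) → let open LeftModule (Chains (suc k)) in
        delete (suc k) $ η (v ∷ x) ≈ᴹ η x +ᴹ (-ᴹ (cone k v $ (delete k $ η x)))
      delete-cons k v x@(_ ∷ _) =
        +ᴹ-cong (*ₗ-identityˡ (η x))
          (≈ᴹ-sym (sum-hom (negate (cone k v)) (suc k)
            (λ i → LeftModule._*ₗ_ (Chains k) ((- 1#) ^ toℕ i) (η (removeAt x i)))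
            (λ i → ((- 1#) ^ toℕ (suc i)) *ₗ face i)
            λ i → ≈ᴹ-sym (≈ᴹ-trans (*ₗ-assoc (- 1#) ((- 1#) ^ toℕ i) (face i))
              (ModuleProperties.-1*≈- (Chains (suc k)) _))))
        where
        open LeftModule (Chains (suc k))
        face : Fin (suc k) → Carrierᴹ
        face i = η (removeAt (v ∷ x) (suc i))

      delete-cone : ∀ k v t → let open LeftModule (Chains (suc k)) in
        delete (suc k) $ (cone (suc k) v $ t) ≈ᴹ t +ᴹ (-ᴹ (cone k v $ (delete k $ t)))
      delete-cone k v = ext (Vec V (suc k))
        (delete (suc k) ∘ₗ cone (suc k) v) (idₗ ⊞ negate (cone k v ∘ₗ delete k))
        (delete-cons k v)

      delete-cone₀ : ∀ v t → LeftModule._≈ᴹ_ (Chains 0) (delete 0 $ (cone 0 v $ t)) t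
      delete-cone₀ v = ext (Vec V 0) (delete 0 ∘ₗ cone 0 v) idₗ
        λ { [] → ≈ᴹ-trans (+ᴹ-identityʳ _) (*ₗ-identityˡ _) }
        where open LeftModule (Chains 0)

    delete² : ∀ k t → let open LeftModule (Chains k) in
              delete k $ (delete (suc k) $ t) ≈ᴹ 0ᴹ
    delete² k = ext (Vec V (suc (suc k))) (delete k ∘ₗ delete (suc k)) (zeroMap _ (Chains k))
      λ { (v ∷ x) → begin
        delete k $ (delete (suc k) $ η (v ∷ x))
          ≈⟨ LinearMap.cong (delete k) (delete-cons k v x) ⟩
        (delete k $ η x) +ᴹ (-ᴹ (delete k $ (cone k v $ (delete k $ η x))))
          ≈⟨ +ᴹ-congˡ (-ᴹ‿cong (lemma k v x)) ⟩
        (delete k $ η x) +ᴹ (-ᴹ (delete k $ η x))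
          ≈⟨ -ᴹ‿inverseʳ _ ⟩
        0ᴹ ∎ }
      where
      open LeftModule (Chains k)
      open SetoidReasoning ≈ᴹ-setoid
      lemma : ∀ k v (x : Vec V (suc k)) → LeftModule._≈ᴹ_ (Chains k)
        (delete k $ (cone k v $ (delete k $ η x))) (delete k $ η x)
      lemma zero    v x = delete-cone₀ v (delete 0 $ η x)
      lemma (suc k) v x = K.≈ᴹ-trans (delete-cone k v (delete (suc k) $ η x))
        (K.≈ᴹ-trans
          (K.+ᴹ-congˡ (K.≈ᴹ-trans
            (K.-ᴹ‿cong (K.≈ᴹ-trans (LinearMap.cong (cone k v) (delete² k (η x)))
                                   (LinearMap.0-hom (cone k v))))
            (ModuleProperties.-ᴹ0≈0 (Chains (suc k)))))
          (K.+ᴹ-identityʳ _))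
        where module K = LeftModule (Chains (suc k))

    R-module : LeftModule ring c ℓ
    R-module = TensorUnit.leftModule

    augmentation : LinearMap (Chains 1) R-module
    augmentation = extend (Vec V 1) R-module λ _ → 1#

    augmentation-delete : ∀ t → augmentation $ (delete 1 $ t) ≈ 0#
    augmentation-delete t = R.trans (factor (delete 1 $ t)) (LinearMap.cong κ (delete² 0 t))
      where
      κ : LinearMap (Chains 0) R-module
      κ = extend (Vec V 0) R-module λ _ → 1#

      factor : ∀ s → augmentation $ s ≈ κ $ (delete 0 $ s)
      factor = ext (Vec V 1) augmentation (κ ∘ₗ delete 0)
        λ _ → R.sym (R.trans (R.+-identityʳ _) (R.*-identityˡ 1#))

  module RegularPathHomology (G : Digraph) where
    open Digraph G
    open Tuples V

    Λ : ℕ → LeftModule ring c (c ⊔ ℓ)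
    Λ m = Chains (suc m)

    ∂ : ∀ m → LinearMap (Λ (suc m)) (Λ m)
    ∂ m = delete (suc m)

    𝒜 : ∀ m → Submodule (Λ m) (c ⊔ ℓ)
    𝒜 m = Span (Λ m) {I = Σ (Vec V (suc m)) λ x → StronglyRegular G x × Allowed G x}
            λ (x , _) → η x

    Ω : ∀ m → Submodule (Λ m) (c ⊔ ℓ)
    Ω zero    = 𝒜 zero
    Ω (suc m) = 𝒜 (suc m) ∩ Preimage (∂ m) (𝒜 m)

    ∂-closed : ∀ m {v} → v ∈ Submodule.Member (Ω (suc m)) →
               LinearMap.⟦_⟧ (∂ m) v ∈ Submodule.Member (Ω m)
    ∂-closed zero    (_ , ∂v∈)     = ∂v∈
    ∂-closed (suc m) {v} (_ , ∂v∈) =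
      ∂v∈ , resp (LeftModule.≈ᴹ-sym (Λ m) (delete² (suc m) v)) 0∈
      where open Submodule (𝒜 m)

    ∂-Ω : ∀ m → LinearMap ⟨ Ω (suc m) ⟩ ⟨ Ω m ⟩
    ∂-Ω m = restrict (∂ m) (Ω (suc m)) (Ω m) (∂-closed m)

    ε-Ω : LinearMap ⟨ Ω 0 ⟩ R-module
    ε-Ω = domRestrict augmentation (Ω 0)

    private
      O : LeftModule ring (c ⊔ ℓ) (c ⊔ ℓ)
      O = ZeroModule.leftModule

    -- Homology of  ⋯ → Ω₁ → Ω₀ → R → 0 → ⋯  with R in degree -1.
    ReducedHomology : ℤ → LeftModule ring (c ⊔ ℓ) (c ⊔ ℓ)
    ReducedHomology (+ suc m)    =
      Homology (∂-Ω (suc m)) (∂-Ω m) λ (v , _) → delete² (suc m) v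
    ReducedHomology (+ zero)     =
      Homology (∂-Ω 0) ε-Ω λ (v , _) → augmentation-delete v
    ReducedHomology -[1+ zero ]  =
      Homology ε-Ω (zeroMap R-module O) λ _ → LeftModule.≈ᴹ-refl O
    ReducedHomology -[1+ suc _ ] = O

{-# OPTIONS --safe #-}

-- For the complete graph, Ω is the complex of injective words.  In the free
-- associative algebra on the vertices the boundary is the graded derivation
-- sending every letter to 1, so it kills the iterated graded commutators
-- [u, a] = [u₁, [u₂, … [uₚ, a]]] with p ≥ 1.  Let a be the first letter of the
-- alphabet.  The words without a, the words a v, and the elements [u, a] v with
-- u nonempty form another basis.  The first two families span a contractible
-- complex (a cone with apex a), and for every u the elements [u, a] v span a
-- shifted copy of the complex of injective words in the remaining letters.
-- Iterating, the complex contracts onto the products [u₁, a₁] [u₂, a₂] … that use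
-- all letters.  Choosing the letters of such a product one at a time gives the
-- recursion D(m + 2) = (m + 1) (D(m) + D(m + 1)) for their number.

module Submission where

open import Algebra.Bundles using (CommutativeRing; CommutativeMonoid)
open import Algebra.Module.Bundles using (LeftModule)
import Algebra.Module.Construct.TensorUnit as TensorUnit
import Algebra.Properties.CommutativeMonoid.Sum as CommutativeMonoidSum
import Algebra.Properties.CommutativeSemigroup as CommutativeSemigroupProperties
import Algebra.Properties.Monoid.Sum as MonoidSum
import Algebra.Properties.Ring as RingProperties
import Algebra.Properties.Semiring.Exp as SemiringExp
open import Data.Fin.Base using (Fin; zero; suc; toℕ; inject₁; fromℕ; punchIn; punchOut)
import Data.Fin.Permutation as Permutation
import Data.Fin.Permutation.Components as Components
import Data.Fin.Properties as Fin
open import Data.Fin.Properties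
  using (suc-injective; punchIn-injective; punchIn-punchOut; +↔⊎; *↔×; toℕ-inject₁; toℕ-fromℕ; toℕ≤pred[n])
open import Data.Integer.Base as ℤ using (ℤ; +_; -[1+_]; -1ℤ; _-_)
import Data.Integer.Properties as ℤ
open import Data.Integer.Tactic.RingSolver using (solve-∀)
open import Data.List.Base using (List; []; _∷_; _++_; length; map; concatMap; filter; lookup; allFin)
import Data.List.Properties as List
open import Data.List.Properties using (filter-all; filter-reject; length-filter; length-++; length-map)
open import Data.List.Membership.Propositional using (_∈_; _∉_; find; lose)
open import Data.List.Membership.Propositional.Properties
  using (∈-++⁺ˡ; ∈-++⁺ʳ; ∈-++⁻; ∈-∃++; ∈-map⁺; ∈-map⁻; ∈-concatMap⁺; ∈-concatMap⁻; ∈-lookup; ∈-allFin)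
open import Data.List.Relation.Binary.Disjoint.Propositional using (Disjoint)
open import Data.List.Relation.Binary.Permutation.Propositional
  using (_↭_; ↭-refl; ↭-sym; ↭-trans; prep; swap; ↭⇒↭ₛ)
open import Data.List.Relation.Binary.Permutation.Propositional.Properties
  using (shift; filter-↭; drop-∷; ∈-resp-↭; ++⁺ʳ; ++⁺ˡ; ↭-length; ¬x∷xs↭[]; ++-assoc; ++-identityʳ)
open import Data.List.Relation.Binary.Permutation.Setoid.Properties using (Unique-resp-↭)
open import Data.List.Relation.Unary.All as All using ([]; _∷_)
open import Data.List.Relation.Unary.All.Properties using (¬Any⇒All¬)
open import Data.List.Relation.Unary.AllPairs using ([]; _∷_)
open import Data.List.Relation.Unary.Any as Any using (here; there)
open import Data.List.Relation.Unary.Any.Properties using (lookup-index)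
open import Data.List.Relation.Unary.Unique.Propositional using (Unique)
open import Data.List.Relation.Unary.Unique.Propositional.Properties
  using (Unique[x∷xs]⇒x∉xs; filter⁺; map⁺; ++⁺; allFin⁺)
open import Data.Nat.Base as ℕ using (ℕ; zero; suc; _≤_; _<_; s≤s; _!)
open import Data.Nat.Combinatorics using (k![n∸k]!∣n!)
open import Data.Nat.Divisibility using (_∣_; m*n∣⇒m∣)
open import Data.Nat.DivMod using (_/_; *-/-assoc; n/n≡1)
import Data.Nat.Properties as ℕ
open import Data.Nat.Properties using (_!≢0)
open import Data.Product.Base as Product using (Σ; ∃; ∃₂; ∃-syntax; _×_; _,_; proj₁; proj₂; uncurry)
open import Data.Product.Properties using (,-injectiveʳ)
open import Data.Sum.Base as Sum using (_⊎_; inj₁; inj₂)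
open import Data.Vec.Base using (Vec; []; _∷_; removeAt; toList; fromList)
import Data.Vec.Properties as Vec
import Data.Vec.Relation.Unary.All as VecAll
import Data.Vec.Relation.Unary.All.Properties as VecAll
import Data.Vec.Relation.Unary.AllPairs as VecAllPairs
open import Data.Vec.Relation.Unary.Linked using (Linked; []; [-]; _∷_)
open import Data.Vec.Relation.Unary.Unique.Propositional using () renaming (Unique to UniqueVec)
open import Function.Base using (_∘_)
open import Function.Bundles using (Inverse; Injection)
open import Function.Properties.Bijection using (Bijection⇒Inverse)
open import Function.Properties.Inverse using (↔⇒↣)
open import Level using (Level; _⊔_; 0ℓ)
open import Relation.Binary.Core using (REL)
open import Relation.Binary.Definitions using (DecidableEquality; tri<; tri≈; tri>)
open import Relation.Binary.PropositionalEquality as ≡ using (_≡_; _≢_; refl; setoid)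
import Relation.Binary.Reasoning.Setoid as SetoidReasoning
open import Relation.Nullary using (¬_; ¬?; yes; no; contradiction)
open import Relation.Unary using (Pred)
open import Defs

-- The obstacle is that cutting a word as u a v at the letter a yields only a filtration: deleting a
-- letter of u leads to a piece with a shorter u. Passing to [u, a] v makes the sum direct, because
-- the derivation replaces a letter by the scalar 1, whose graded commutators vanish. That the new
-- elements form a basis is never stated as such: `expandₗ` defines a map by prescribed values on
-- them, `expandₗ-bracket` and `expand-absent` show that it takes these values, and `expand-linear`
-- recovers a linear map from its values there. All maps live on the free module on all words;
-- injectivity is only a hypothesis on the word at which an identity is checked. The result is the
-- identity id = ∂ h + h ∂ + β ρ, where ∂ β = 0 and ρ β = id on critical codes, and ρ kills every
-- word that misses a letter. So cycles below the top degree bound, and the critical products are a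
-- basis at the top, where there are no longer injective words to bound them. If [u, a] is read as
-- the cycle (a u), a critical code is a permutation in cycle notation, and nonempty u excludes
-- fixed points: this is why derangements appear.

-- Lists without repetition, and complements of words in an alphabet

module _ {A : Set} where
  Unique-resp : ∀ {xs ys : List A} → xs ↭ ys → Unique xs → Unique ys
  Unique-resp p = Unique-resp-↭ (≡.setoid A) (↭⇒↭ₛ p)

  Unique-tail : ∀ {x : A} {xs} → Unique (x ∷ xs) → Unique xs
  Unique-tail (_ ∷ xs!) = xs!

  ↭-∷-∷ : ∀ {a x : A} {w v} → w ↭ a ∷ v → x ∷ w ↭ a ∷ x ∷ v
  ↭-∷-∷ p = ↭-trans (prep _ p) (swap _ _ ↭-refl)

  ∈⇒↭ : ∀ {x : A} {xs} → x ∈ xs → ∃ λ ys → xs ↭ x ∷ ys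
  ∈⇒↭ x∈ with ys , zs , refl ← ∈-∃++ x∈ = ys ++ zs , shift _ ys zs

module Removal {V : Set} (_≟_ : DecidableEquality V) where

  remove : V → List V → List V
  remove x = filter λ y → ¬? (x ≟ y)

  infixl 6 _∖_
  -- Filtering keeps the order of S, so the head of the complement is the next distinguished letter.
  _∖_ : List V → List V → List V
  S ∖ []      = S
  S ∖ (x ∷ u) = remove x S ∖ u

  remove-↭ : ∀ {x S X} → Unique S → S ↭ x ∷ X → remove x S ↭ X
  remove-↭ {x} {S} {X} S! p = ↭-trans (filter-↭ (λ y → ¬? (x ≟ y)) p)
    (≡.subst (_↭ X) (≡.sym (≡.trans (filter-reject (λ y → ¬? (x ≟ y)) λ x≢x → x≢x refl)
      (filter-all (λ y → ¬? (x ≟ y)) (¬Any⇒All¬ _ (Unique[x∷xs]⇒x∉xs (Unique-resp p S!))))))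
      ↭-refl)

  ∖-unique : ∀ u {S} → Unique S → Unique (S ∖ u)
  ∖-unique []      S! = S!
  ∖-unique (x ∷ u) S! = ∖-unique u (filter⁺ (λ y → ¬? (x ≟ y)) S!)

  ∖-↭ : ∀ u {S X} → Unique S → S ↭ u ++ X → S ∖ u ↭ X
  ∖-↭ []      S! p = p
  ∖-↭ (x ∷ u) S! p = ∖-↭ u (filter⁺ (λ y → ¬? (x ≟ y)) S!) (remove-↭ S! p)

  ∖-length : ∀ u S → length (S ∖ u) ≤ length S
  ∖-length []      S = ℕ.≤-refl
  ∖-length (x ∷ u) S = ℕ.≤-trans (∖-length u (remove x S)) (length-filter (λ y → ¬? (x ≟ y)) S)

-- Enumeration of the critical codes

subfactorial : ℕ → ℕ
subfactorial 0             = 1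
subfactorial 1             = 0
subfactorial (suc (suc m)) = suc m ℕ.* (subfactorial m ℕ.+ subfactorial (suc m))

module _ {A B C : Set} (g : A → B → C) (f : A → List B) where

  fan : List A → List C
  fan = concatMap λ x → map (g x) (f x)

  ∈-fan⁺ : ∀ {x y xs} → x ∈ xs → y ∈ f x → g x y ∈ fan xs
  ∈-fan⁺ x∈ y∈ = ∈-concatMap⁺ _ (lose x∈ (∈-map⁺ _ y∈))

  ∈-fan⁻ : ∀ {z} xs → z ∈ fan xs → ∃₂ λ x y → x ∈ xs × y ∈ f x × z ≡ g x y
  ∈-fan⁻ xs z∈ with x , x∈ , z∈′ ← find (∈-concatMap⁻ _ {xs} z∈)
    with y , y∈ , e ← ∈-map⁻ (g x) z∈′ = x , y , x∈ , y∈ , e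

  fan-length : ∀ {k} xs → (∀ {x} → x ∈ xs → length (f x) ≡ k) → length (fan xs) ≡ length xs ℕ.* k
  fan-length []       e = refl
  fan-length (x ∷ xs) e = ≡.trans (length-++ (map (g x) (f x)))
    (≡.cong₂ ℕ._+_ (≡.trans (length-map (g x) (f x)) (e (here refl))) (fan-length xs λ x∈ → e (there x∈)))

  fan-unique : (∀ {x x′ y y′} → g x y ≡ g x′ y′ → x ≡ x′ × y ≡ y′) →
    ∀ {xs} → Unique xs → (∀ {x} → x ∈ xs → Unique (f x)) → Unique (fan xs)
  fan-unique inj {[]}     _   u = []
  fan-unique inj {x ∷ xs} xs! u = ++⁺ (map⁺ (λ e → proj₂ (inj e)) (u (here refl)))
    (fan-unique inj (Unique-tail xs!) (λ x∈ → u (there x∈))) disjoint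
    where
    disjoint : Disjoint (map (g x) (f x)) (fan xs)
    disjoint (p , q) with y , _ , refl ← ∈-map⁻ (g x) p
      with x′ , y′ , x′∈ , _ , e ← ∈-fan⁻ xs q
      with refl , _ ← inj e = Unique[x∷xs]⇒x∉xs xs! x′∈

module Enumeration {V : Set} (_≟_ : DecidableEquality V) where
  open Removal _≟_

  Word Code : Set
  Word = List V
  Code = List Word

  -- The code u₁, u₂, … over the alphabet S stands for [u₁, a₁] [u₂, a₂] …, where
  -- aᵢ is the first letter of S not used before.
  data Critical : Word → Code → Set where
    []   : Critical [] []
    _∷_ : ∀ {a S x u X c} → S ↭ (x ∷ u) ++ X → Critical (S ∖ (x ∷ u)) c →
           Critical (a ∷ S) ((x ∷ u) ∷ c)

  -- An unfinished code is kept as the pair of its first, still growing block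
  -- and the remaining blocks.
  closed : ℕ → Word → List Code
  opened : ℕ → Word → List (Word × Code)
  opened⁺ : ℕ → Word → List (Word × Code)

  grow : V → Word × Code → Word × Code
  grow x (u , c) = x ∷ u , c

  closed _       []      = [] ∷ []
  -- The number is fuel, since `remove` does not return a structural sublist; under the bound length
  -- S ≤ n this clause is never reached.
  closed zero    (a ∷ S) = []
  closed (suc n) (a ∷ S) = map (uncurry _∷_) (opened⁺ n S)

  opened n S = map ([] ,_) (closed n S) ++ opened⁺ n S

  opened⁺ zero    S = []
  opened⁺ (suc n) S = fan grow (λ x → opened n (remove x S)) S

  removed : ∀ {n x S} → length S ≤ suc n → Unique S → x ∈ S →
    Unique (remove x S) × suc (length (remove x S)) ≡ length S × length (remove x S) ≤ n
  removed {x = x} l S! x∈ with X , p ← ∈⇒↭ x∈ =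
    filter⁺ (λ y → ¬? (x ≟ y)) S! , e , ℕ.≤-pred (ℕ.≤-trans (ℕ.≤-reflexive e) l)
    where e = ≡.trans (≡.cong suc (↭-length (remove-↭ S! p))) (≡.sym (↭-length p))

  Opened : Word → Word × Code → Set
  Opened S (u , c) = (∃ λ X → S ↭ u ++ X) × Critical (S ∖ u) c

  closed-sound : ∀ n {S c} → length S ≤ n → Unique S → c ∈ closed n S → Critical S c
  opened-sound : ∀ n {S o} → length S ≤ n → Unique S → o ∈ opened n S → Opened S o
  opened⁺-sound : ∀ n {S o} → length S ≤ n → Unique S → o ∈ opened⁺ n S →
    ∃₂ λ x u → ∃ λ c → o ≡ (x ∷ u , c) × Opened S o

  closed-sound n       {[]}    l S! (here refl) = []
  closed-sound (suc n) {a ∷ S} (s≤s l) S! c∈ with o , o∈ , refl ← ∈-map⁻ (uncurry _∷_) c∈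
    with x , u , c , refl , (X , p) , κ ← opened⁺-sound n l (Unique-tail S!) o∈ = p ∷ κ

  opened-sound n {S} l S! o∈ with ∈-++⁻ (map ([] ,_) (closed n S)) o∈
  ... | inj₁ p with c , c∈ , refl ← ∈-map⁻ ([] ,_) p = (_ , ↭-refl) , closed-sound n l S! c∈
  ... | inj₂ p = proj₂ (proj₂ (proj₂ (proj₂ (opened⁺-sound n l S! p))))

  opened⁺-sound (suc n) {S} l S! o∈ with x , (u , c) , x∈ , uc∈ , refl ← ∈-fan⁻ _ _ S o∈
    with S∖x! , _ , l′ ← removed l S! x∈
    with (X , p) , κ ← opened-sound n l′ S∖x! uc∈
    with Y , q ← ∈⇒↭ x∈ =
    x , u , c , refl , (X , ↭-trans q (prep x (↭-trans (↭-sym (remove-↭ S! q)) p))) , κ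

  closed-complete : ∀ n {S c} → length S ≤ n → Unique S → Critical S c → c ∈ closed n S
  opened-complete : ∀ n {S o} → length S ≤ n → Unique S → Opened S o → o ∈ opened n S
  opened⁺-complete : ∀ n {S x u c} → length S ≤ n → Unique S → Opened S (x ∷ u , c) →
    (x ∷ u , c) ∈ opened⁺ n S

  closed-complete n       l       S! []      = here refl
  closed-complete (suc n) (s≤s l) S! (p ∷ κ) =
    ∈-map⁺ (uncurry _∷_) (opened⁺-complete n l (Unique-tail S!) ((_ , p) , κ))

  opened-complete n {S} {[]    , c} l S! (_ , κ) = ∈-++⁺ˡ (∈-map⁺ ([] ,_) (closed-complete n l S! κ))
  opened-complete n {S} {_ ∷ _ , c} l S! o       = ∈-++⁺ʳ (map ([] ,_) (closed n S)) (opened⁺-complete n l S! o)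

  opened⁺-complete zero    {[]} l S! ((_ , p) , κ) = contradiction (↭-sym p) ¬x∷xs↭[]
  opened⁺-complete (suc n) {S} {x} l S! ((X , p) , κ) =
    let x∈ = ∈-resp-↭ (↭-sym p) (here refl)
        S∖x! , _ , l′ = removed l S! x∈
    in ∈-fan⁺ _ _ x∈ (opened-complete n l′ S∖x! ((X , remove-↭ S! p) , κ))

  closed-unique : ∀ n {S} → length S ≤ n → Unique S → Unique (closed n S)
  opened-unique : ∀ n {S} → length S ≤ n → Unique S → Unique (opened n S)
  opened⁺-unique : ∀ n {S} → length S ≤ n → Unique S → Unique (opened⁺ n S)

  closed-unique n       {[]}    l       S! = [] ∷ []
  closed-unique (suc n) {a ∷ S} (s≤s l) S! =
    map⁺ (λ e → ≡.cong₂ _,_ (List.∷-injectiveˡ e) (List.∷-injectiveʳ e)) (opened⁺-unique n l (Unique-tail S!))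

  opened-unique n {S} l S! = ++⁺ (map⁺ ,-injectiveʳ (closed-unique n l S!)) (opened⁺-unique n l S!) disjoint
    where
    disjoint : Disjoint (map ([] ,_) (closed n S)) (opened⁺ n S)
    disjoint (p , q) with _ , _ , refl ← ∈-map⁻ ([] ,_) p
      with _ , _ , _ , () , _ ← opened⁺-sound n l S! q

  opened⁺-unique zero    l S! = []
  opened⁺-unique (suc n) l S! = fan-unique grow _ (λ { refl → refl , refl }) S!
    λ x∈ → let S∖x! , _ , l′ = removed l S! x∈ in opened-unique n l′ S∖x!

  -- `opened⁺` over k letters counts like `closed` over k + 1 letters, because the distinguished
  -- letter of the growing block has already left the alphabet.
  closed-length : ∀ n {S} → length S ≤ n → Unique S → length (closed n S) ≡ subfactorial (length S)
  opened-length : ∀ n {S} → length S ≤ n → Unique S →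
    length (opened n S) ≡ subfactorial (length S) ℕ.+ subfactorial (suc (length S))
  opened⁺-length : ∀ n {S} → length S ≤ n → Unique S → length (opened⁺ n S) ≡ subfactorial (suc (length S))

  closed-length n       {[]}    l       S! = refl
  closed-length (suc n) {a ∷ S} (s≤s l) S! =
    ≡.trans (length-map (uncurry _∷_) (opened⁺ n S)) (opened⁺-length n l (Unique-tail S!))

  opened-length n {S} l S! = ≡.trans (length-++ (map ([] ,_) (closed n S)))
    (≡.cong₂ ℕ._+_ (≡.trans (length-map ([] ,_) (closed n S)) (closed-length n l S!)) (opened⁺-length n l S!))

  opened⁺-length zero    {[]}        l S! = refl
  opened⁺-length (suc n) {[]}        l S! = refl
  opened⁺-length (suc n) {S@(_ ∷ S′)} l S! = fan-length grow (λ x → opened n (remove x S)) S λ x∈ →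
    let S∖x! , e , l′ = removed l S! x∈
    in ≡.trans (opened-length n l′ S∖x!) (≡.cong (λ k → subfactorial k ℕ.+ subfactorial (suc k)) (ℕ.suc-injective e))

-- Derangements satisfy the same recursion

module CountDerangements where
  open Permutation
    using (Permutation′; _⟨$⟩ʳ_; _∘ₚ_; lift₀; transpose; insert; remove;
           insert-punchIn; punchIn-permute; insert-remove; lift₀-remove)

  private
    variable
      m n : ℕ

  Derangement : ℕ → Set
  Derangement n = Σ (Permutation′ n) λ π → ∀ i → π ⟨$⟩ʳ i ≢ i

  -- What remains of a derangement once the point 0 is cut out: y stands for the former image of 0,
  -- and it becomes fixed exactly when the two formed a 2-cycle.
  FixesAtMost : Fin n → Set
  FixesAtMost {n} y = Σ (Permutation′ n) λ π → (∀ i → π ⟨$⟩ʳ i ≡ i → i ≡ y)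

  injective : (π : Permutation′ n) → ∀ {i j} → π ⟨$⟩ʳ i ≡ π ⟨$⟩ʳ j → i ≡ j
  injective π = Injection.injective (↔⇒↣ π)

  insertFixed : (y : Fin (suc m)) → Derangement m → FixesAtMost y
  insertFixed y (π , π≢) = insert y y π , fixes
    where
    fixes : ∀ i → insert y y π ⟨$⟩ʳ i ≡ i → i ≡ y
    fixes i e with y Fin.≟ i
    ... | yes y≡i = ≡.sym y≡i
    ... | no y≢i = contradiction
      (punchIn-injective y _ _ (≡.trans e (≡.sym (punchIn-punchOut y≢i)))) (π≢ _)

  insert-fixes : ∀ (y : Fin (suc m)) (π : Permutation′ m) → insert y y π ⟨$⟩ʳ y ≡ y
  insert-fixes y π with y Fin.≟ y
  ... | yes _  = refl
  ... | no y≢y = contradiction refl y≢y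

  splitFixed : (y : Fin (suc m)) → Derangement m ⊎ Derangement (suc m) → FixesAtMost y
  splitFixed y (inj₁ π)        = insertFixed y π
  splitFixed y (inj₂ (π , π≢)) = π , λ i e → contradiction e (π≢ i)

  splitFixed-surjective : ∀ (y : Fin (suc m)) (π : FixesAtMost y) → ∃ λ s → proj₁ (splitFixed y s) Permutation.≈ proj₁ π
  splitFixed-surjective y (π , fixes) with (π ⟨$⟩ʳ y) Fin.≟ y
  ... | no πy≢y  = inj₂ (π , λ i e → πy≢y (≡.subst (λ j → π ⟨$⟩ʳ j ≡ j) (fixes i e) e)) , λ _ → refl
  ... | yes πy≡y = inj₁ (remove y π , derangement) ,
      λ i → ≡.trans (≡.cong (λ z → insert y z (remove y π) ⟨$⟩ʳ i) (≡.sym πy≡y)) (insert-remove y π i)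
    where
    derangement : ∀ i → remove y π ⟨$⟩ʳ i ≢ i
    derangement i e = Fin.punchInᵢ≢i y i (fixes (punchIn y i)
      (≡.trans (punchIn-permute π y i) (≡.cong₂ punchIn πy≡y e)))

  -- Reinserts 0 into a permutation of the remaining points so that 0 ↦ suc y,
  -- hence a fixed point at y does no harm.
  attach : (y : Fin n) → FixesAtMost y → Derangement (suc n)
  attach y (τ , fixes) = lift₀ τ ∘ₚ transpose zero (suc y) , derangement
    where
    derangement : ∀ i → lift₀ τ ∘ₚ transpose zero (suc y) ⟨$⟩ʳ i ≢ i
    derangement zero    ()
    derangement (suc i) e with (τ ⟨$⟩ʳ i) Fin.≟ y
    derangement (suc i) () | yes _
    ... | no τi≢y = τi≢y (≡.trans τi≡i (fixes i τi≡i))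
      where τi≡i = suc-injective e

  attach-surjective : ∀ (σ : Derangement (suc n)) →
    ∃ λ y → ∃ λ (τ : FixesAtMost y) → proj₁ (attach {n} y τ) Permutation.≈ proj₁ σ
  attach-surjective (σ , σ≢) with σ ⟨$⟩ʳ zero in σ0
  ... | zero  = contradiction σ0 (σ≢ zero)
  ... | suc y = y , (remove zero ρ , fixes) , λ i →
      ≡.trans (≡.cong (Components.transpose zero (suc y)) (lift₀-remove ρ ρ0 i))
              (Components.transpose-inverse zero (suc y))
    where
    ρ = σ ∘ₚ transpose (suc y) zero
    ρ0 : ρ ⟨$⟩ʳ zero ≡ zero
    ρ0 rewrite σ0 with y Fin.≟ y
    ... | yes _  = refl
    ... | no y≢y = contradiction refl y≢y
    fixes : ∀ i → remove zero ρ ⟨$⟩ʳ i ≡ i → i ≡ y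
    fixes i e with i Fin.≟ y in eq
    ... | yes i≡y = i≡y
    -- The transposition moves neither `suc i` nor its image, so a fixed point other than y would
    -- already be fixed by `σ`.
    ... | no i≢y  = contradiction (≡.trans (≡.sym (Components.transpose-inverse zero (suc y)))
        (≡.trans (≡.cong (Components.transpose zero (suc y)) (≡.trans (≡.sym (lift₀-remove ρ ρ0 (suc i))) (≡.cong suc e)))
          fixed)) (σ≢ (suc i))
      where
      fixed : Components.transpose zero (suc y) (suc i) ≡ suc i
      fixed rewrite eq = refl

  _≈_ : Derangement n → Derangement n → Set
  (π , _) ≈ (ρ , _) = π Permutation.≈ ρ

  attach-injective : ∀ (y z : Fin n) (τ : FixesAtMost y) (ρ : FixesAtMost z) → attach y τ ≈ attach z ρ →
    y ≡ z × proj₁ τ Permutation.≈ proj₁ ρ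
  attach-injective y z τ ρ e with refl ← suc-injective (e zero) =
    refl , λ i → suc-injective (injective (transpose zero (suc y)) (e (suc i)))

  attach-cong : ∀ (y : Fin n) (τ ρ : FixesAtMost y) → proj₁ τ Permutation.≈ proj₁ ρ → attach y τ ≈ attach y ρ
  attach-cong y τ ρ e zero    = refl
  attach-cong y τ ρ e (suc i) = ≡.cong (λ k → Components.transpose zero (suc y) (suc k)) (e i)

  splitFixed-cong₁ : ∀ (y : Fin (suc m)) (π ρ : Derangement m) → π ≈ ρ →
    proj₁ (splitFixed y (inj₁ π)) Permutation.≈ proj₁ (splitFixed y (inj₁ ρ))
  splitFixed-cong₁ y π ρ e i with y Fin.≟ i
  ... | yes _  = refl
  ... | no y≢i = ≡.cong (punchIn y) (e (punchOut y≢i))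

  join : Fin (suc m) × (Derangement m ⊎ Derangement (suc m)) → Derangement (suc (suc m))
  join (y , s) = attach y (splitFixed y s)

  module _ {A B : Set} (f : A → Derangement m) (g : B → Derangement (suc m)) where

    private
      f⊎g : A ⊎ B → Derangement m ⊎ Derangement (suc m)
      f⊎g = Sum.map f g

    module _ (f-inj : ∀ a a′ → f a ≈ f a′ → a ≡ a′) (g-inj : ∀ b b′ → g b ≈ g b′ → b ≡ b′) where

      -- Whether y is fixed tells the two summands apart; within the first, the permutation is read
      -- off away from y through `punchIn`.
      splitFixed-injective : ∀ y s t →
        proj₁ (splitFixed y (f⊎g s)) Permutation.≈ proj₁ (splitFixed y (f⊎g t)) → s ≡ t
      splitFixed-injective y (inj₁ a) (inj₁ a′) e = ≡.cong inj₁ (f-inj a a′ λ k → punchIn-injective y _ _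
        (≡.trans (≡.sym (insert-punchIn y y (proj₁ (f a)) k))
          (≡.trans (e (punchIn y k)) (insert-punchIn y y (proj₁ (f a′)) k))))
      splitFixed-injective y (inj₂ b) (inj₂ b′) e = ≡.cong inj₂ (g-inj b b′ e)
      splitFixed-injective y (inj₁ a) (inj₂ b)  e = contradiction
        (≡.trans (≡.sym (e y)) (insert-fixes y (proj₁ (f a)))) (proj₂ (g b) y)
      splitFixed-injective y (inj₂ b) (inj₁ a)  e = contradiction
        (≡.trans (e y) (insert-fixes y (proj₁ (f a)))) (proj₂ (g b) y)

      join-injective : ∀ p q → join (Product.map₂ f⊎g p) ≈ join (Product.map₂ f⊎g q) → p ≡ q
      join-injective (y , s) (z , t) e
        with refl , e′ ← attach-injective y z (splitFixed y (f⊎g s)) (splitFixed z (f⊎g t)) e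
        = ≡.cong (y ,_) (splitFixed-injective y s t e′)

    module _ (f-surj : ∀ π → ∃ λ a → f a ≈ π) (g-surj : ∀ π → ∃ λ b → g b ≈ π) where

      splitFixed-map-surjective : ∀ y s → ∃ λ t →
        proj₁ (splitFixed y (f⊎g t)) Permutation.≈ proj₁ (splitFixed y s)
      splitFixed-map-surjective y (inj₁ π) with a , e ← f-surj π = inj₁ a , splitFixed-cong₁ y (f a) π e
      splitFixed-map-surjective y (inj₂ π) with b , e ← g-surj π = inj₂ b , e

      join-surjective : ∀ σ → ∃ λ p → join (Product.map₂ f⊎g p) ≈ σ
      join-surjective σ =
        let y , τ , e  = attach-surjective σ
            s , e′     = splitFixed-surjective y τ
            t , e″     = splitFixed-map-surjective y s
        in (y , t) , λ i →
          ≡.trans (attach-cong y (splitFixed y (f⊎g t)) τ (λ j → ≡.trans (e″ j) (e′ j)) i) (e i)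

  decode : Fin (suc m ℕ.* (subfactorial m ℕ.+ subfactorial (suc m))) →
           Fin (suc m) × (Fin (subfactorial m) ⊎ Fin (subfactorial (suc m)))
  decode {m} k = Product.map₂ (Inverse.to (+↔⊎ {subfactorial m})) (Inverse.to (*↔× {suc m}) k)

  decode-injective : ∀ {k l} → decode {m} k ≡ decode l → k ≡ l
  decode-injective {m} e = Injection.injective (↔⇒↣ (*↔× {suc m}))
    (≡.cong₂ _,_ (≡.cong proj₁ e) (Injection.injective (↔⇒↣ (+↔⊎ {subfactorial m})) (≡.cong proj₂ e)))

  decode-surjective : ∀ p → ∃ λ k → decode {m} k ≡ p
  decode-surjective {m} (y , s) = Inverse.from (*↔× {suc m}) (y , Inverse.from (+↔⊎ {subfactorial m}) s) ,
    ≡.trans (≡.cong (Product.map₂ (Inverse.to (+↔⊎ {subfactorial m}))) (Inverse.strictlyInverseˡ (*↔× {suc m}) _))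
      (≡.cong (y ,_) (Inverse.strictlyInverseˡ (+↔⊎ {subfactorial m}) s))

  derangements : ∀ n → Fin (subfactorial n) → Derangement n
  derangements 0             _ = Permutation.id , λ ()
  derangements (suc (suc m)) k =
    join (Product.map₂ (Sum.map (derangements m) (derangements (suc m))) (decode {m} k))

  derangements-injective : ∀ n i j → derangements n i ≈ derangements n j → i ≡ j
  derangements-injective 0 zero zero e = refl
  derangements-injective (suc (suc m)) k l e = decode-injective (join-injective
    (derangements m) (derangements (suc m)) (derangements-injective m) (derangements-injective (suc m))
    (decode {m} k) (decode l) e)

  derangements-surjective : ∀ n (σ : Derangement n) → ∃ λ k → derangements n k ≈ σ
  derangements-surjective 0 σ = zero , λ ()
  derangements-surjective 1 (σ , σ≢) with σ ⟨$⟩ʳ zero in σ0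
  ... | zero = contradiction σ0 (σ≢ zero)
  derangements-surjective (suc (suc m)) σ =
    let p , e    = join-surjective (derangements m) (derangements (suc m))
                     (derangements-surjective m) (derangements-surjective (suc m)) σ
        k , dk≡p = decode-surjective {m} p
    in k , λ i → ≡.trans
         (≡.cong (λ p → proj₁ (join (Product.map₂ (Sum.map (derangements m) (derangements (suc m))) p)) ⟨$⟩ʳ i) dk≡p) (e i)

  Fin↔Derangements : ∀ n → Inverse (setoid (Fin (subfactorial n))) (Derangements n)
  Fin↔Derangements n = Bijection⇒Inverse record
    { to        = derangements n
    ; cong      = λ { refl _ → refl }
    ; bijective = (λ {i} {j} → derangements-injective n i j) , λ σ →
        let k , e = derangements-surjective n σ in k , λ { refl → e }
    }

-- The alternating sum for the number of derangements

module DerangementNumbers where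
  open MonoidSum ℤ.+-0-monoid using (sum; sum-init-last; sum-cong-≗)

  D-term : ℕ → ℕ → ℤ
  D-term n j = (-1ℤ ℤ.^ j) ℤ.* (+ (_/_ (n !) (j !) {{j !≢0}}))

  -- As j ≤ n, the factorial of j divides that of n, so the factor n + 1 can be taken out of the
  -- integer division.
  D-term-suc : ∀ {n j} → j ≤ n → D-term (suc n) j ≡ + suc n ℤ.* D-term n j
  D-term-suc {n} {j} j≤n = begin
    s ℤ.* + (suc n ℕ.* n ! / j !)      ≡⟨ ≡.cong (λ k → s ℤ.* + k) (*-/-assoc (suc n) j!∣n!) ⟩
    s ℤ.* + (suc n ℕ.* (n ! / j !))    ≡⟨ ≡.cong (s ℤ.*_) (ℤ.pos-* (suc n) (n ! / j !)) ⟩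
    s ℤ.* (+ suc n ℤ.* + (n ! / j !))  ≡⟨ x∙yz≡y∙xz s (+ suc n) (+ (n ! / j !)) ⟩
    + suc n ℤ.* (s ℤ.* + (n ! / j !))  ∎
    where
    open ≡.≡-Reasoning
    instance _ = j !≢0
    s = -1ℤ ℤ.^ j
    j!∣n! : j ! ∣ n !
    j!∣n! = m*n∣⇒m∣ (j !) _ (k![n∸k]!∣n! j≤n)
    x∙yz≡y∙xz : ∀ a b c → a ℤ.* (b ℤ.* c) ≡ b ℤ.* (a ℤ.* c)
    x∙yz≡y∙xz = solve-∀

  D-term-last : ∀ n → D-term n n ≡ -1ℤ ℤ.^ n
  D-term-last n = ≡.trans (≡.cong (λ k → (-1ℤ ℤ.^ n) ℤ.* + k) (n/n≡1 (n !))) (ℤ.*-identityʳ _)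
    where instance _ = n !≢0

  sum-distribˡ : ∀ c {n} (f : Fin n → ℤ) → sum (λ i → c ℤ.* f i) ≡ c ℤ.* sum f
  sum-distribˡ c {zero}  f = ≡.sym (ℤ.*-zeroʳ c)
  sum-distribˡ c {suc n} f = ≡.trans (≡.cong (λ s → c ℤ.* f zero ℤ.+ s) (sum-distribˡ c (f ∘ suc)))
    (≡.sym (ℤ.*-distribˡ-+ c (f zero) _))

  D-suc : ∀ n → D (suc n) ≡ + suc n ℤ.* D n ℤ.+ -1ℤ ℤ.^ suc n
  D-suc n = begin
    sum {suc (suc n)} (D-term (suc n) ∘ toℕ)
      ≡⟨ sum-init-last {suc n} (D-term (suc n) ∘ toℕ) ⟩
    sum {suc n} (D-term (suc n) ∘ toℕ ∘ inject₁) ℤ.+ D-term (suc n) (toℕ (fromℕ (suc n)))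
      ≡⟨ ≡.cong₂ ℤ._+_
           (sum-cong-≗ {suc n} λ i → ≡.trans (≡.cong (D-term (suc n)) (toℕ-inject₁ i)) (D-term-suc (toℕ≤pred[n] i)))
           (≡.trans (≡.cong (D-term (suc n)) (toℕ-fromℕ (suc n))) (D-term-last (suc n))) ⟩
    sum {suc n} (λ i → + suc n ℤ.* D-term n (toℕ i)) ℤ.+ -1ℤ ℤ.^ suc n
      ≡⟨ ≡.cong (λ s → s ℤ.+ -1ℤ ℤ.^ suc n) (sum-distribˡ (+ suc n) {suc n} (D-term n ∘ toℕ)) ⟩
    + suc n ℤ.* D n ℤ.+ -1ℤ ℤ.^ suc n ∎
    where open ≡.≡-Reasoning

  subfactorial-suc : ∀ n → + subfactorial (suc n) ≡ + suc n ℤ.* + subfactorial n ℤ.+ -1ℤ ℤ.^ suc n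
  subfactorial-suc zero    = refl
  subfactorial-suc (suc n) = begin
    + (suc n ℕ.* (s₀ ℕ.+ s₁))                          ≡⟨ ℤ.pos-* (suc n) (s₀ ℕ.+ s₁) ⟩
    + suc n ℤ.* (+ s₀ ℤ.+ + s₁)                        ≡⟨ rearrange (+ suc n) (+ s₀) (+ s₁) e ⟩
    -- The inner bracket is the right-hand side of the induction hypothesis; replacing it by s₁
    -- makes it cancel, which trades (n + 1) s₀ for s₁ - e.
    (+ 1 ℤ.+ + suc n) ℤ.* + s₁ ℤ.+
      ((+ suc n ℤ.* + s₀ ℤ.+ e) ℤ.+ -1ℤ ℤ.* + s₁) ℤ.+ -1ℤ ℤ.* e
      ≡⟨ ≡.cong (λ t → + suc (suc n) ℤ.* + s₁ ℤ.+ (t ℤ.+ -1ℤ ℤ.* + s₁) ℤ.+ -1ℤ ℤ.* e) (subfactorial-suc n) ⟨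
    + suc (suc n) ℤ.* + s₁ ℤ.+ (+ s₁ ℤ.+ -1ℤ ℤ.* + s₁) ℤ.+ -1ℤ ℤ.* e
      ≡⟨ cancel (+ suc (suc n) ℤ.* + s₁) (+ s₁) (-1ℤ ℤ.* e) ⟩
    + suc (suc n) ℤ.* + s₁ ℤ.+ -1ℤ ℤ.* e               ∎
    where
    open ≡.≡-Reasoning
    s₀ = subfactorial n
    s₁ = subfactorial (suc n)
    e = -1ℤ ℤ.^ suc n
    rearrange : ∀ m a b e → m ℤ.* (a ℤ.+ b) ≡
      (+ 1 ℤ.+ m) ℤ.* b ℤ.+ ((m ℤ.* a ℤ.+ e) ℤ.+ -1ℤ ℤ.* b) ℤ.+ -1ℤ ℤ.* e
    rearrange = solve-∀
    cancel : ∀ a b c → a ℤ.+ (b ℤ.+ -1ℤ ℤ.* b) ℤ.+ c ≡ a ℤ.+ c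
    cancel = solve-∀

  subfactorial≡D : ∀ n → + subfactorial n ≡ D n
  subfactorial≡D zero    = refl
  subfactorial≡D (suc n) = ≡.trans (subfactorial-suc n)
    (≡.trans (≡.cong (λ d → + suc n ℤ.* d ℤ.+ -1ℤ ℤ.^ suc n) (subfactorial≡D n)) (≡.sym (D-suc n)))

-- Linear maps and signs

module LinearAlgebra {c ℓ : Level} (R : CommutativeRing c ℓ) where
  open Modules R
  module R = CommutativeRing R
  open R using (Carrier; _≈_; _+_; _*_; -_; 0#; 1#; ring)
  open RingProperties ring using (-1*x≈-x; -‿involutive)

  infixr 8 _$_
  _$_ : ∀ {m ℓm n ℓn} {M : LeftModule ring m ℓm} {N : LeftModule ring n ℓn} →
        LinearMap M N → LeftModule.Carrierᴹ M → LeftModule.Carrierᴹ N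
  _$_ = LinearMap.⟦_⟧

  idₗ : ∀ {m ℓm} {M : LeftModule ring m ℓm} → LinearMap M M
  idₗ {M = M} = record
    { ⟦_⟧ = λ x → x ; cong = λ p → p ; +-hom = λ _ _ → ≈ᴹ-refl ; *-hom = λ _ _ → ≈ᴹ-refl }
    where open LeftModule M

  module _ {m ℓm n ℓn} {M : LeftModule ring m ℓm} {N : LeftModule ring n ℓn} where
    open LeftModule N
    open ModuleProperties N using (+ᴹ-interchange)

    infixl 6 _+ₗ_
    _+ₗ_ : LinearMap M N → LinearMap M N → LinearMap M N
    f +ₗ g = record
      { ⟦_⟧   = λ x → f $ x +ᴹ g $ x
      ; cong  = λ p → +ᴹ-cong (f.cong p) (g.cong p)
      ; +-hom = λ x y → ≈ᴹ-trans (+ᴹ-cong (f.+-hom x y) (g.+-hom x y)) (+ᴹ-interchange _ _ _ _)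
      ; *-hom = λ r x → ≈ᴹ-trans (+ᴹ-cong (f.*-hom r x) (g.*-hom r x)) (≈ᴹ-sym (*ₗ-distribˡ r _ _))
      }
      where
      module f = LinearMap f
      module g = LinearMap g

    *ₗ-swap : ∀ r s x → r *ₗ (s *ₗ x) ≈ᴹ s *ₗ (r *ₗ x)
    *ₗ-swap r s x = ≈ᴹ-trans (≈ᴹ-sym (*ₗ-assoc r s x))
      (≈ᴹ-trans (*ₗ-cong (R.*-comm r s) ≈ᴹ-refl) (*ₗ-assoc s r x))

    infixr 7 _·ₗ_
    _·ₗ_ : Carrier → LinearMap M N → LinearMap M N
    r ·ₗ f = record
      { ⟦_⟧   = λ x → r *ₗ (f $ x)
      ; cong  = λ p → *ₗ-cong R.refl (f.cong p)
      ; +-hom = λ x y → ≈ᴹ-trans (*ₗ-cong R.refl (f.+-hom x y)) (*ₗ-distribˡ r _ _)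
      ; *-hom = λ s x → ≈ᴹ-trans (*ₗ-cong R.refl (f.*-hom s x)) (*ₗ-swap r s _)
      }
      where module f = LinearMap f

  -1# : Carrier
  -1# = - 1#

  -1*-1≈1 : -1# * -1# ≈ 1#
  -1*-1≈1 = R.trans (-1*x≈-x -1#) (-‿involutive 1#)

  module Cancel {m ℓm} (M : LeftModule ring m ℓm) where
    open LeftModule M
    open SetoidReasoning ≈ᴹ-setoid

    +-cancel : ∀ x → x +ᴹ -1# *ₗ x ≈ᴹ 0ᴹ
    +-cancel x = begin
      x +ᴹ -1# *ₗ x        ≈⟨ +ᴹ-congʳ (*ₗ-identityˡ x) ⟨
      1# *ₗ x +ᴹ -1# *ₗ x  ≈⟨ *ₗ-distribʳ x 1# -1# ⟨
      (1# + -1#) *ₗ x      ≈⟨ *ₗ-cong (R.-‿inverseʳ 1#) ≈ᴹ-refl ⟩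
      0# *ₗ x              ≈⟨ *ₗ-zeroˡ x ⟩
      0ᴹ                   ∎

    -1*-1*-cancel : ∀ x → -1# *ₗ (-1# *ₗ x) ≈ᴹ x
    -1*-1*-cancel x = ≈ᴹ-trans (≈ᴹ-sym (*ₗ-assoc -1# -1# x))
      (≈ᴹ-trans (*ₗ-cong -1*-1≈1 ≈ᴹ-refl) (*ₗ-identityˡ x))

-- The boundary of words and graded commutators

module InjectiveWords {c ℓ : Level} (R : CommutativeRing c ℓ) {V : Set} (_≟_ : DecidableEquality V) where
  open Modules R
  open LinearAlgebra R
  open Enumeration _≟_ using (Word)
  open R using (Carrier; _≈_; _*_; 1#; ring)

  T : LeftModule ring c (c ⊔ ℓ)
  T = Free Word

  module T = LeftModule T
  open Cancel T
  open T using (_+ᴹ_; _*ₗ_; 0ᴹ; ≈ᴹ-refl; ≈ᴹ-sym; ≈ᴹ-trans; *ₗ-cong; +ᴹ-cong; +ᴹ-congˡ; +ᴹ-congʳ;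
               *ₗ-distribˡ; *ₗ-assoc; +ᴹ-assoc; +ᴹ-identityˡ; *ₗ-identityˡ)
    renaming (_≈ᴹ_ to _≋_)
  open ModuleProperties T using (+ᴹ-interchange)

  sign : Word → Carrier
  sign []      = 1#
  sign (_ ∷ u) = -1# * sign u

  sign² : ∀ u → sign u * sign u ≈ 1#
  sign² []      = R.*-identityˡ 1#
  sign² (_ ∷ u) = begin
    (-1# * sign u) * (-1# * sign u)  ≈⟨ interchange -1# (sign u) -1# (sign u) ⟩
    (-1# * -1#) * (sign u * sign u)  ≈⟨ R.*-cong -1*-1≈1 (sign² u) ⟩
    1# * 1#                          ≈⟨ R.*-identityˡ 1# ⟩
    1#                               ∎
    where
    open SetoidReasoning R.setoid
    open CommutativeSemigroupProperties (CommutativeMonoid.commutativeSemigroup R.*-commutativeMonoid)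
      using (interchange)

  left : V → LinearMap T T
  left x = extend Word T λ w → η (x ∷ w)

  -- The alternating sum of faces in the form of a Leibniz rule. The empty word sits in degree -1,
  -- so on one-letter words this is the augmentation.
  ∂-word : Word → T.Carrierᴹ
  ∂-word []      = 0ᴹ
  ∂-word (x ∷ w) = η w +ᴹ -1# *ₗ (left x $ ∂-word w)

  ∂ : LinearMap T T
  ∂ = extend Word T ∂-word

  ∂-left : ∀ x t → ∂ $ left x $ t ≋ t +ᴹ -1# *ₗ (left x $ ∂ $ t)
  ∂-left x = ext Word (∂ ∘ₗ left x) (idₗ +ₗ -1# ·ₗ (left x ∘ₗ ∂)) λ _ → ≈ᴹ-refl

  module _ (a : V) where

    -- Left multiplication by the graded commutator [u₁, [u₂, … [uₚ, a]]], where
    -- [x, y] = x y - (-1)^|y| y x for a letter x.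
    bracket : Word → LinearMap T T
    bracket []      = left a
    bracket (x ∷ u) = left x ∘ₗ bracket u +ₗ sign u ·ₗ (bracket u ∘ₗ left x)

    private
      -- Left multiplication by ∂ [u, a], which is 1 for empty u and 0 otherwise.
      whenEmpty : Word → LinearMap T T
      whenEmpty []      = idₗ
      whenEmpty (_ ∷ _) = zeroMap T T

      whenEmpty-left : ∀ x u t → sign u *ₗ (whenEmpty u $ left x $ t) ≋ left x $ whenEmpty u $ t
      whenEmpty-left x []      t = *ₗ-identityˡ _
      whenEmpty-left x (_ ∷ u) t = T.*ₗ-zeroʳ _

      -- The graded Leibniz rule for the product of [u, a] and t. Empty u is included, although it
      -- gives an extra term, because the induction starts there.
      ∂-bracket′ : ∀ u t →
        ∂ $ bracket u $ t ≋ whenEmpty u $ t +ᴹ sign (a ∷ u) *ₗ (bracket u $ ∂ $ t)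
      ∂-bracket′ []      t = ≈ᴹ-trans (∂-left a t)
        (+ᴹ-congˡ (*ₗ-cong (R.sym (R.*-identityʳ -1#)) ≈ᴹ-refl))
      ∂-bracket′ (x ∷ u) t = begin
        ∂ $ left x $ bracket u $ t +ᴹ s *ₗ (∂ $ bracket u $ left x $ t)
          ≈⟨ +ᴹ-cong (∂-left x (bracket u $ t)) (*ₗ-cong R.refl (∂-bracket′ u (left x $ t))) ⟩
        (P +ᴹ -1# *ₗ (left x $ ∂ $ bracket u $ t)) +ᴹ
          s *ₗ (whenEmpty u $ left x $ t +ᴹ -s *ₗ (bracket u $ ∂ $ left x $ t))
          ≈⟨ +ᴹ-cong (+ᴹ-congˡ (*ₗ-cong R.refl first))
                     (≈ᴹ-trans (*ₗ-distribˡ s _ _) (+ᴹ-cong (whenEmpty-left x u t) second)) ⟩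
        -- The terms P, in which x is deleted, arise from both orders of the commutator with
        -- opposite signs. So do the terms O, which come from deleting a when u is empty.
        (P +ᴹ -1# *ₗ (O +ᴹ -s *ₗ Q)) +ᴹ (O +ᴹ -1# *ₗ (P +ᴹ -1# *ₗ W))
          ≈⟨ collect ⟩
        Q′ +ᴹ W
          ≈⟨ +ᴹ-cong (≈ᴹ-sym (*ₗ-assoc -1# -s Q)) W≈ ⟩
        (-1# * -s) *ₗ Q +ᴹ (-1# * -s) *ₗ (s *ₗ W)
          ≈⟨ *ₗ-distribˡ (-1# * -s) Q (s *ₗ W) ⟨
        (-1# * -s) *ₗ (Q +ᴹ s *ₗ W)
          ≈⟨ +ᴹ-identityˡ _ ⟨
        0ᴹ +ᴹ (-1# * -s) *ₗ (Q +ᴹ s *ₗ W) ∎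
        where
        open SetoidReasoning T.≈ᴹ-setoid
        s -s : Carrier
        s  = sign u
        -s = -1# * s
        P Q W O Q′ : T.Carrierᴹ
        P  = bracket u $ t
        Q  = left x $ bracket u $ ∂ $ t
        W  = bracket u $ left x $ ∂ $ t
        O  = left x $ whenEmpty u $ t
        Q′ = -1# *ₗ (-s *ₗ Q)
        first : left x $ ∂ $ bracket u $ t ≋ O +ᴹ -s *ₗ Q
        first = LinearMap.cong (left x) (∂-bracket′ u t)
        s*-s : s * -s ≈ -1#
        s*-s = R.trans (R.sym (R.*-assoc s -1# s)) (R.trans (R.*-congʳ (R.*-comm s -1#))
          (R.trans (R.*-assoc -1# s s) (R.trans (R.*-congˡ (sign² u)) (R.*-identityʳ -1#))))
        second : s *ₗ (-s *ₗ (bracket u $ ∂ $ left x $ t)) ≋ -1# *ₗ (P +ᴹ -1# *ₗ W)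
        second = ≈ᴹ-trans (≈ᴹ-sym (*ₗ-assoc s -s _)) (*ₗ-cong s*-s
          (≈ᴹ-trans (LinearMap.cong (bracket u) (∂-left x t))
            (≈ᴹ-trans (LinearMap.+-hom (bracket u) _ _)
                      (+ᴹ-congˡ (LinearMap.*-hom (bracket u) -1# _)))))
        W≈ : W ≋ (-1# * -s) *ₗ (s *ₗ W)
        W≈ = ≈ᴹ-trans (≈ᴹ-sym (*ₗ-identityˡ W)) (≈ᴹ-trans (*ₗ-cong (R.sym unit) ≈ᴹ-refl) (*ₗ-assoc _ s W))
          where
          unit : (-1# * -s) * s ≈ 1#
          unit = R.trans (R.*-congʳ (R.trans (R.sym (R.*-assoc -1# -1# s))
            (R.trans (R.*-congʳ -1*-1≈1) (R.*-identityˡ s)))) (sign² u)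
        collect : (P +ᴹ -1# *ₗ (O +ᴹ -s *ₗ Q)) +ᴹ (O +ᴹ -1# *ₗ (P +ᴹ -1# *ₗ W)) ≋ Q′ +ᴹ W
        collect = begin
          (P +ᴹ -1# *ₗ (O +ᴹ -s *ₗ Q)) +ᴹ (O +ᴹ -1# *ₗ (P +ᴹ -1# *ₗ W))
            ≈⟨ +ᴹ-cong (+ᴹ-congˡ (*ₗ-distribˡ -1# O _))
                 (+ᴹ-congˡ (≈ᴹ-trans (*ₗ-distribˡ -1# P _) (+ᴹ-congˡ (-1*-1*-cancel W)))) ⟩
          (P +ᴹ (-1# *ₗ O +ᴹ Q′)) +ᴹ (O +ᴹ (-1# *ₗ P +ᴹ W))
            ≈⟨ +ᴹ-cong (+ᴹ-assoc P _ Q′) (+ᴹ-assoc O _ W) ⟨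
          ((P +ᴹ -1# *ₗ O) +ᴹ Q′) +ᴹ ((O +ᴹ -1# *ₗ P) +ᴹ W)
            ≈⟨ +ᴹ-interchange _ Q′ _ W ⟩
          ((P +ᴹ -1# *ₗ O) +ᴹ (O +ᴹ -1# *ₗ P)) +ᴹ (Q′ +ᴹ W)
            ≈⟨ +ᴹ-congʳ (≈ᴹ-trans (+ᴹ-congˡ (T.+ᴹ-comm O _)) (≈ᴹ-trans (+ᴹ-interchange P _ _ O)
                 (≈ᴹ-trans (+ᴹ-cong (+-cancel P) (≈ᴹ-trans (T.+ᴹ-comm _ O) (+-cancel O))) (+ᴹ-identityˡ 0ᴹ)))) ⟩
          0ᴹ +ᴹ (Q′ +ᴹ W)
            ≈⟨ +ᴹ-identityˡ _ ⟩
          Q′ +ᴹ W ∎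

    ∂-bracket : ∀ x u t → ∂ $ bracket (x ∷ u) $ t ≋ sign (a ∷ x ∷ u) *ₗ (bracket (x ∷ u) $ ∂ $ t)
    ∂-bracket x u t = ≈ᴹ-trans (∂-bracket′ (x ∷ u) t) (+ᴹ-identityˡ _)

-- The change of basis from words to brackets

module Expansion {c ℓ : Level} (R : CommutativeRing c ℓ) {V : Set} (_≟_ : DecidableEquality V) where
  open Modules R
  open LinearAlgebra R
  open InjectiveWords R _≟_
  open Enumeration _≟_ using (Word)
  open R using (ring)

  module _ (a : V) where

    module _ {n ℓn} (N : LeftModule ring n ℓn) where
      open LeftModule N

      -- The linear map with  bracket a u $ η v ↦ k u v  and  w ↦ k₀ w  for words w
      -- without a, evaluated at a word; the recursion is
      -- x [u, a] v = [x u, a] v + (-1)^(|u| + 1) [u, a] x v.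
      expand : (Word → Word → Carrierᴹ) → (Word → Carrierᴹ) → Word → Carrierᴹ
      expand k k₀ []      = k₀ []
      expand k k₀ (x ∷ w) with x ≟ a
      ... | yes _ = k [] w
      ... | no  _ = expand (λ u v → k (x ∷ u) v +ᴹ sign (a ∷ u) *ₗ k u (x ∷ v)) (λ w → k₀ (x ∷ w)) w

      expandₗ : (Word → Word → Carrierᴹ) → (Word → Carrierᴹ) → LinearMap T N
      expandₗ k k₀ = extend Word N (expand k k₀)

      expandₗ-left-≡ : ∀ k k₀ t → expandₗ k k₀ $ left a $ t ≈ᴹ extend Word N (k []) $ t
      expandₗ-left-≡ k k₀ = ext Word (expandₗ k k₀ ∘ₗ left a) (extend Word N (k [])) lemma
        where
        lemma : ∀ w → expand k k₀ (a ∷ w) ≈ᴹ k [] w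
        lemma w with a ≟ a
        ... | yes _  = ≈ᴹ-refl
        ... | no a≢a = contradiction refl a≢a

      expandₗ-left-≢ : ∀ {x} → x ≢ a → ∀ k k₀ t →
        expandₗ k k₀ $ left x $ t ≈ᴹ
        expandₗ (λ u v → k (x ∷ u) v +ᴹ sign (a ∷ u) *ₗ k u (x ∷ v)) (λ w → k₀ (x ∷ w)) $ t
      expandₗ-left-≢ {x} x≢a k k₀ = ext Word (expandₗ k k₀ ∘ₗ left x) (expandₗ _ _) lemma
        where
        lemma : ∀ w → expand k k₀ (x ∷ w) ≈ᴹ expand _ _ w
        lemma w with x ≟ a
        ... | yes x≡a = contradiction x≡a x≢a
        ... | no _    = ≈ᴹ-refl

      -- The recursion of `expand` undoes that of `bracket`: the summand added in k′ cancels the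
      -- contribution of [u, a] x t. No condition on t is needed, as `expand` stops at the first a,
      -- which is the one of the bracket.
      expandₗ-bracket : ∀ u → a ∉ u → ∀ k k₀ t →
        expandₗ k k₀ $ bracket a u $ t ≈ᴹ extend Word N (k u) $ t
      expandₗ-bracket []      a∉u k k₀ t = expandₗ-left-≡ k k₀ t
      expandₗ-bracket (x ∷ u) a∉u k k₀ t = begin
        expandₗ k k₀ $ left x $ bracket a u $ t +ᴹ sign u *ₗ (expandₗ k k₀ $ bracket a u $ left x $ t)
          ≈⟨ +ᴹ-cong (≈ᴹ-trans (expandₗ-left-≢ (λ x≡a → a∉u (here (≡.sym x≡a))) k k₀ (bracket a u $ t))
                               (expandₗ-bracket u (λ a∈ → a∉u (there a∈)) k′ _ t))
                     (*ₗ-cong R.refl (expandₗ-bracket u (λ a∈ → a∉u (there a∈)) k k₀ (left x $ t))) ⟩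
        extend Word N (k′ u) $ t +ᴹ sign u *ₗ (K $ left x $ t)
          ≈⟨ +ᴹ-congʳ (ext Word (extend Word N (k′ u))
               (extend Word N (k (x ∷ u)) +ₗ sign (a ∷ u) ·ₗ (K ∘ₗ left x)) (λ _ → ≈ᴹ-refl) t) ⟩
        (extend Word N (k (x ∷ u)) $ t +ᴹ sign (a ∷ u) *ₗ (K $ left x $ t)) +ᴹ sign u *ₗ (K $ left x $ t)
          ≈⟨ +ᴹ-assoc _ _ _ ⟩
        extend Word N (k (x ∷ u)) $ t +ᴹ (sign (a ∷ u) *ₗ (K $ left x $ t) +ᴹ sign u *ₗ (K $ left x $ t))
          ≈⟨ +ᴹ-congˡ (≈ᴹ-trans (+ᴹ-comm _ _) (≈ᴹ-trans (+ᴹ-congˡ (*ₗ-assoc -1# (sign u) _)) (+-cancel _))) ⟩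
        extend Word N (k (x ∷ u)) $ t +ᴹ 0ᴹ
          ≈⟨ +ᴹ-identityʳ _ ⟩
        extend Word N (k (x ∷ u)) $ t ∎
        where
        open SetoidReasoning ≈ᴹ-setoid
        open Cancel N
        k′ : Word → Word → Carrierᴹ
        k′ u v = k (x ∷ u) v +ᴹ sign (a ∷ u) *ₗ k u (x ∷ v)
        K : LinearMap T N
        K = extend Word N (k u)

      expand-absent : ∀ w → a ∉ w → ∀ k k₀ → expand k k₀ w ≈ᴹ k₀ w
      expand-absent []      a∉w k k₀ = ≈ᴹ-refl
      expand-absent (x ∷ w) a∉w k k₀ with x ≟ a
      ... | yes x≡a = contradiction (here (≡.sym x≡a)) a∉w
      ... | no _    = expand-absent w (λ a∈ → a∉w (there a∈)) _ _

      -- Deleting letters cannot create an a, so every face of w is again handled by k₀.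
      expandₗ-∂-absent : ∀ w → a ∉ w → ∀ k k₀ →
        expandₗ k k₀ $ ∂ $ η w ≈ᴹ extend Word N k₀ $ ∂ $ η w
      expandₗ-∂-absent []      a∉w k k₀ = ≈ᴹ-refl
      expandₗ-∂-absent (x ∷ w) a∉w k k₀ = +ᴹ-cong (expand-absent w a∉w′ k k₀)
        (*ₗ-cong R.refl (≈ᴹ-trans (expandₗ-left-≢ (λ x≡a → a∉w (here (≡.sym x≡a))) k k₀ (∂ $ η w))
          (≈ᴹ-trans (expandₗ-∂-absent w a∉w′ _ _)
            (ext Word (extend Word N λ w → k₀ (x ∷ w)) (extend Word N k₀ ∘ₗ left x) (λ _ → ≈ᴹ-refl) (∂ $ η w)))))
        where
        a∉w′ : a ∉ w
        a∉w′ a∈ = a∉w (there a∈)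

    module _ {m ℓm n ℓn r} {M : LeftModule ring m ℓm} {N : LeftModule ring n ℓn}
             (_~_ : REL (LeftModule.Carrierᴹ M) (LeftModule.Carrierᴹ N) r)
             (+~ : ∀ {x x′ y y′} → x ~ y → x′ ~ y′ → LeftModule._+ᴹ_ M x x′ ~ LeftModule._+ᴹ_ N y y′)
             (*~ : ∀ s {x y} → x ~ y → LeftModule._*ₗ_ M s x ~ LeftModule._*ₗ_ N s y) where

      -- Every pair (u, v) that the expansion reaches rearranges the letters of w, so the hypotheses
      -- are only required for such pairs. Stated for a relation, one induction yields both
      -- `expand-cong` and `expand-∈`.
      expand-rel : ∀ w {k k₀ k′ k₀′} →
        (∀ u v → w ↭ a ∷ u ++ v → k u v ~ k′ u v) → (a ∉ w → k₀ w ~ k₀′ w) →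
        expand M k k₀ w ~ expand N k′ k₀′ w
      expand-rel []      p q = q λ ()
      expand-rel (x ∷ w) p q with x ≟ a
      ... | yes refl = p [] w ↭-refl
      ... | no x≢a   = expand-rel w
        (λ u v e → +~ (p (x ∷ u) v (↭-∷-∷ e))
          (*~ (sign (a ∷ u)) (p u (x ∷ v) (↭-trans (↭-∷-∷ e) (prep a (↭-sym (shift x u v)))))))
        (λ a∉w → q λ { (here a≡x) → x≢a (≡.sym a≡x) ; (there a∈w) → a∉w a∈w })

    module _ {n ℓn} (N : LeftModule ring n ℓn) where
      open LeftModule N

      expand-cong : ∀ w {k k₀ k′ k₀′} →
        (∀ u v → w ↭ a ∷ u ++ v → k u v ≈ᴹ k′ u v) → (a ∉ w → k₀ w ≈ᴹ k₀′ w) →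
        expand N k k₀ w ≈ᴹ expand N k′ k₀′ w
      expand-cong = expand-rel {M = N} {N = N} _≈ᴹ_ +ᴹ-cong (λ s → *ₗ-cong (R.refl {s}))

      expand-∈ : ∀ {p} (P : Submodule N p) (let open Submodule P) w {k k₀} →
        (∀ u v → w ↭ a ∷ u ++ v → Member (k u v)) → (a ∉ w → Member (k₀ w)) →
        Member (expand N k k₀ w)
      expand-∈ P w {k} {k₀} p q =
        expand-rel {M = N} {N = N} (λ x _ → Submodule.Member P x)
          (λ p q → Submodule.+∈ P p q) (λ s p → Submodule.*∈ P s p) w {k} {k₀} {k} {k₀} p q

      -- Moving x into the bracket adds a multiple of [u, a] x v, which the correction term of
      -- `expand` removes. With this, an identity of linear maps at w can be checked on the new
      -- elements.
      expand-linear : ∀ w (g : LinearMap T N) →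
        expand N (λ u v → g $ bracket a u $ η v) (λ w → g $ η w) w ≈ᴹ g $ η w
      expand-linear []      g = ≈ᴹ-refl
      expand-linear (x ∷ w) g with x ≟ a
      ... | yes refl = ≈ᴹ-refl
      ... | no _     = ≈ᴹ-trans
        (expand-cong w {k₀ = λ w → g $ η (x ∷ w)} (λ u v _ → begin
          g $ (left x $ B u v +ᴹᵀ sign u *ₗᵀ B u (x ∷ v)) +ᴹ sign (a ∷ u) *ₗ (g $ B u (x ∷ v))
            ≈⟨ +ᴹ-cong (≈ᴹ-trans (LinearMap.+-hom g (left x $ B u v) _)
                                 (+ᴹ-congˡ (LinearMap.*-hom g (sign u) (B u (x ∷ v)))))
                       (*ₗ-assoc -1# (sign u) _) ⟩
          (g $ left x $ B u v +ᴹ sign u *ₗ (g $ B u (x ∷ v))) +ᴹ -1# *ₗ (sign u *ₗ (g $ B u (x ∷ v)))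
            ≈⟨ ≈ᴹ-trans (+ᴹ-assoc _ _ _) (+ᴹ-congˡ (+-cancel _)) ⟩
          g $ left x $ B u v +ᴹ 0ᴹ
            ≈⟨ +ᴹ-identityʳ _ ⟩
          g $ left x $ B u v ∎)
          (λ _ → ≈ᴹ-refl))
        (expand-linear w (g ∘ₗ left x))
        where
        open SetoidReasoning ≈ᴹ-setoid
        open Cancel N
        open LeftModule T using () renaming (_+ᴹ_ to _+ᴹᵀ_; _*ₗ_ to _*ₗᵀ_)
        B : Word → Word → T.Carrierᴹ
        B u v = bracket a u $ η v

-- The contracting homotopy

module Homotopy {c ℓ : Level} (R : CommutativeRing c ℓ) {V : Set} (_≟_ : DecidableEquality V) where
  open Modules R
  open LinearAlgebra R
  open InjectiveWords R _≟_
  open Removal _≟_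
  open Expansion R _≟_
  open Enumeration _≟_ using (Word; Code)
  open R using (ring)
  open Cancel T
  open T using (_+ᴹ_; _*ₗ_; 0ᴹ; ≈ᴹ-refl; ≈ᴹ-sym; ≈ᴹ-trans; *ₗ-cong; +ᴹ-cong; +ᴹ-congˡ; +ᴹ-congʳ;
               *ₗ-assoc; +ᴹ-assoc; +ᴹ-comm; +ᴹ-identityʳ; +ᴹ-identityˡ; *ₗ-identityˡ; *ₗ-zeroʳ)
    renaming (_≈ᴹ_ to _≋_)

  span-map : ∀ {m ℓm n ℓn i p} {M : LeftModule ring m ℓm} {N : LeftModule ring n ℓn}
    {I : Set i} {g : I → LeftModule.Carrierᴹ M} (f : LinearMap M N) (P : Submodule N p) →
    (∀ j → Submodule.Member P (f $ g j)) → ∀ {t} → InSpan M g t → Submodule.Member P (f $ t)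
  span-map f P q (span-gen j)    = q j
  span-map f P q (span-resp e t) = Submodule.resp P (LinearMap.cong f e) (span-map f P q t)
  span-map {N = N} f P q span-0  = Submodule.resp P (LeftModule.≈ᴹ-sym N (LinearMap.0-hom f)) (Submodule.0∈ P)
  span-map {N = N} f P q (span-+ s t) = Submodule.resp P (LeftModule.≈ᴹ-sym N (LinearMap.+-hom f _ _))
    (Submodule.+∈ P (span-map f P q s) (span-map f P q t))
  span-map {N = N} f P q (span-* r t) = Submodule.resp P (LeftModule.≈ᴹ-sym N (LinearMap.*-hom f r _))
    (Submodule.*∈ P r (span-map f P q t))

  C : LeftModule ring c (c ⊔ ℓ)
  C = Free Code

  module C = LeftModule C

  consₗ : Word → LinearMap C C
  consₗ u = extend Code C λ c → η (u ∷ c)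

  -- The clauses with value `0ᴹ` are defaults for codes that do not fit the alphabet.
  cycle-word : Word → Code → T.Carrierᴹ
  cycle-word []      []      = η []
  cycle-word []      (_ ∷ _) = 0ᴹ
  cycle-word (a ∷ S) []      = 0ᴹ
  cycle-word (a ∷ S) (u ∷ c) = bracket a u $ cycle-word (S ∖ u) c

  cycleₗ : Word → LinearMap C T
  cycleₗ S = extend Code T (cycle-word S)

  -- The first argument of homotopy and of critical is fuel: it has to bound the
  -- length of the alphabet.
  homotopy : ℕ → Word → LinearMap T T
  homotopyₖ : ℕ → V → Word → Word → Word → T.Carrierᴹ

  homotopy _       []      = zeroMap T T
  homotopy zero    (a ∷ S) = zeroMap T T
  homotopy (suc n) (a ∷ S) = expandₗ a T (homotopyₖ n a S) (λ w → η (a ∷ w))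

  homotopyₖ n a S []        v = 0ᴹ
  -- The sign is the one from `∂-bracket`. As ∂ and the homotopy both pass the bracket with it, it
  -- occurs squared in each term of the homotopy identity.
  homotopyₖ n a S u@(_ ∷ _) v = sign (a ∷ u) *ₗ (bracket a u $ homotopy n (S ∖ u) $ η v)

  -- The target consists of formal codes rather than of cycles, so that coordinates are available
  -- there. Words without a and words a v are sent to 0, because they span the contractible cone.
  critical : ℕ → Word → LinearMap T C
  criticalₖ : ℕ → Word → Word → Word → C.Carrierᴹ

  critical _       []      = extend Word C λ _ → η []
  critical zero    (a ∷ S) = zeroMap T C
  critical (suc n) (a ∷ S) = expandₗ a C (criticalₖ n S) (λ _ → C.0ᴹ)

  criticalₖ n S []        v = C.0ᴹ
  criticalₖ n S u@(_ ∷ _) v = consₗ u $ critical n (S ∖ u) $ η v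

  module _ (n : ℕ) (a : V) (S : Word) where

    homotopy-left : ∀ t → homotopy (suc n) (a ∷ S) $ left a $ t ≋ 0ᴹ
    homotopy-left t = ≈ᴹ-trans (expandₗ-left-≡ a T (homotopyₖ n a S) (λ w → η (a ∷ w)) t)
      (ext Word (extend Word T λ _ → 0ᴹ) (zeroMap T T) (λ _ → ≈ᴹ-refl) t)

    critical-left : ∀ t → critical (suc n) (a ∷ S) $ left a $ t C.≈ᴹ C.0ᴹ
    critical-left t = C.≈ᴹ-trans (expandₗ-left-≡ a C (criticalₖ n S) (λ _ → C.0ᴹ) t)
      (ext Word (extend Word C λ _ → C.0ᴹ) (zeroMap T C) (λ _ → C.≈ᴹ-refl) t)

    module _ (x : V) (u : Word) (a∉ : a ∉ x ∷ u) where

      homotopy-bracket : ∀ t → homotopy (suc n) (a ∷ S) $ bracket a (x ∷ u) $ t ≋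
                               sign (a ∷ x ∷ u) *ₗ (bracket a (x ∷ u) $ homotopy n (S ∖ (x ∷ u)) $ t)
      homotopy-bracket t = ≈ᴹ-trans (expandₗ-bracket a T (x ∷ u) a∉ (homotopyₖ n a S) (λ w → η (a ∷ w)) t)
        (ext Word (extend Word T (homotopyₖ n a S (x ∷ u)))
          (sign (a ∷ x ∷ u) ·ₗ (bracket a (x ∷ u) ∘ₗ homotopy n (S ∖ (x ∷ u)))) (λ _ → ≈ᴹ-refl) t)

      critical-bracket : ∀ t → critical (suc n) (a ∷ S) $ bracket a (x ∷ u) $ t C.≈ᴹ
                               consₗ (x ∷ u) $ critical n (S ∖ (x ∷ u)) $ t
      critical-bracket t = C.≈ᴹ-trans (expandₗ-bracket a C (x ∷ u) a∉ (criticalₖ n S) (λ _ → C.0ᴹ) t)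
        (ext Word (extend Word C (criticalₖ n S (x ∷ u)))
          (consₗ (x ∷ u) ∘ₗ critical n (S ∖ (x ∷ u))) (λ _ → C.≈ᴹ-refl) t)

  cycleₗ-cons : ∀ a S u t → cycleₗ (a ∷ S) $ consₗ u $ t ≋ bracket a u $ cycleₗ (S ∖ u) $ t
  cycleₗ-cons a S u = ext Code (cycleₗ (a ∷ S) ∘ₗ consₗ u) (bracket a u ∘ₗ cycleₗ (S ∖ u)) λ _ → ≈ᴹ-refl

  module _ {a : V} {S w r : Word} (aS! : Unique (a ∷ S)) (p : a ∷ S ↭ w ++ r) where

    private
      split : ∀ {u v} → w ↭ a ∷ u ++ v → S ↭ u ++ v ++ r
      split {u} {v} e = drop-∷ (↭-trans p (↭-trans (++⁺ʳ r e) (prep a (++-assoc u v r))))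

    -- The letters r that w misses in the alphabet are also those that v misses in the complement of
    -- u, so r stays the same throughout the recursion.
    split-prefix : ∀ u {v} → w ↭ a ∷ u ++ v → a ∉ u × S ↭ u ++ (S ∖ u) × S ∖ u ↭ v ++ r
    split-prefix u e = (λ a∈ → Unique[x∷xs]⇒x∉xs aS! (∈-resp-↭ (↭-sym q) (∈-++⁺ˡ a∈)))
      , ↭-trans q (++⁺ˡ u (↭-sym s)) , s
      where
      q = split {u} e
      s = ∖-↭ u (Unique-tail aS!) q

    split-∉ : ∀ {v} → w ↭ a ∷ v → a ∉ v
    split-∉ {v} e a∈ = Unique[x∷xs]⇒x∉xs
      (Unique-resp (↭-trans p (++⁺ʳ r e)) aS!) (∈-++⁺ˡ a∈)

    ∉⇒remainder : a ∉ w → ∃ λ r′ → r ↭ a ∷ r′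
    ∉⇒remainder a∉ with ∈-++⁻ w (∈-resp-↭ p (here refl))
    ... | inj₁ a∈w = contradiction a∈w a∉
    ... | inj₂ a∈r = ∈⇒↭ a∈r

  homotopy-identityₗ : ℕ → Word → LinearMap T T
  homotopy-identityₗ n S = ∂ ∘ₗ homotopy n S +ₗ homotopy n S ∘ₗ ∂ +ₗ cycleₗ S ∘ₗ critical n S

  -- All terms are linear, so the change of basis reduces the claim to three families. Two of them
  -- are the cone with apex a; on [u, a] v the bracket can be pulled out, which leaves the claim for
  -- v over the smaller alphabet.
  homotopy-identity : ∀ n S w r → length S ≤ n → Unique S → S ↭ w ++ r →
    homotopy-identityₗ n S $ η w ≋ η w
  homotopy-identity n [] [] r _ _ _ = begin
    (∂ $ h (η []) +ᴹ h 0ᴹ) +ᴹ η []  ≈⟨ +ᴹ-congʳ (+ᴹ-identityˡ 0ᴹ) ⟩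
    0ᴹ +ᴹ η []                      ≈⟨ +ᴹ-identityˡ _ ⟩
    η []                            ∎
    where
    open SetoidReasoning T.≈ᴹ-setoid
    h = LinearMap.⟦_⟧ (homotopy n [])
  homotopy-identity n [] (x ∷ w) r _ _ p = contradiction (↭-sym p) ¬x∷xs↭[]
  homotopy-identity (suc n) (a ∷ S) w r (s≤s S≤n) aS! p = begin
    K $ η w
      ≈⟨ expand-linear a T w K ⟨
    expand a T (λ u v → K $ bracket a u $ η v) (λ w → K $ η w) w
      ≈⟨ expand-cong a T w present absent ⟩
    expand a T (λ u v → bracket a u $ η v) η w
      ≈⟨ expand-linear a T w (idₗ {M = T}) ⟩
    η w ∎
    where
    open SetoidReasoning T.≈ᴹ-setoid
    K H : LinearMap T T
    K = homotopy-identityₗ (suc n) (a ∷ S)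
    H = homotopy (suc n) (a ∷ S)
    ρ : LinearMap T C
    ρ = critical (suc n) (a ∷ S)

    absent : a ∉ w → K $ η w ≋ η w
    absent a∉w = begin
      (∂ $ H $ η w +ᴹ H $ ∂ $ η w) +ᴹ cycleₗ (a ∷ S) $ ρ $ η w
        ≈⟨ +ᴹ-cong (+ᴹ-cong (LinearMap.cong ∂ (expand-absent a T w a∉w (homotopyₖ n a S) _))
             (≈ᴹ-trans (expandₗ-∂-absent a T w a∉w (homotopyₖ n a S) _)
                       (ext Word (extend Word T λ w → η (a ∷ w)) (left a) (λ _ → ≈ᴹ-refl) (∂ $ η w))))
           (LinearMap.cong (cycleₗ (a ∷ S)) (expand-absent a C w a∉w (criticalₖ n S) _)) ⟩
      ((η w +ᴹ -1# *ₗ (left a $ ∂ $ η w)) +ᴹ left a $ ∂ $ η w) +ᴹ 0ᴹ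
        ≈⟨ ≈ᴹ-trans (+ᴹ-identityʳ _) (+ᴹ-assoc _ _ _) ⟩
      η w +ᴹ (-1# *ₗ (left a $ ∂ $ η w) +ᴹ left a $ ∂ $ η w)
        ≈⟨ +ᴹ-congˡ (≈ᴹ-trans (+ᴹ-comm _ _) (+-cancel _)) ⟩
      η w +ᴹ 0ᴹ
        ≈⟨ +ᴹ-identityʳ _ ⟩
      η w ∎

    present : ∀ u v → w ↭ a ∷ u ++ v → K $ bracket a u $ η v ≋ bracket a u $ η v
    present [] v e = begin
      (∂ $ H $ η (a ∷ v) +ᴹ H $ ∂ $ η (a ∷ v)) +ᴹ cycleₗ (a ∷ S) $ ρ $ η (a ∷ v)
        ≈⟨ +ᴹ-cong (+ᴹ-congʳ (LinearMap.cong ∂ (homotopy-left n a S (η v))))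
                   (LinearMap.cong (cycleₗ (a ∷ S)) (critical-left n a S (η v))) ⟩
      (0ᴹ +ᴹ (H $ η v +ᴹ -1# *ₗ (H $ left a $ ∂ $ η v))) +ᴹ 0ᴹ
        ≈⟨ ≈ᴹ-trans (+ᴹ-identityʳ _) (+ᴹ-identityˡ _) ⟩
      H $ η v +ᴹ -1# *ₗ (H $ left a $ ∂ $ η v)
        -- The homotopy returns a v only because v is free of a, which follows from w being
        -- injective.
        ≈⟨ +ᴹ-cong (expand-absent a T v (split-∉ {r = r} aS! p e) (homotopyₖ n a S) _)
                   (≈ᴹ-trans (*ₗ-cong R.refl (homotopy-left n a S (∂ $ η v))) (*ₗ-zeroʳ -1#)) ⟩
      η (a ∷ v) +ᴹ 0ᴹ
        ≈⟨ +ᴹ-identityʳ _ ⟩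
      η (a ∷ v) ∎
    present u@(x ∷ u′) v e with a∉u , _ , q ← split-prefix aS! p u e = begin
      (∂ $ H $ b $ η v +ᴹ H $ ∂ $ b $ η v) +ᴹ cycleₗ (a ∷ S) $ ρ $ b $ η v
        ≈⟨ +ᴹ-cong (+ᴹ-cong ∂H H∂) cycle-part ⟩
      (b $ ∂ $ h $ η v +ᴹ b $ h $ ∂ $ η v) +ᴹ b $ cycleₗ (S ∖ u) $ critical n (S ∖ u) $ η v
        ≈⟨ ≈ᴹ-trans (LinearMap.+-hom b _ _) (+ᴹ-congʳ (LinearMap.+-hom b _ _)) ⟨
      b $ homotopy-identityₗ n (S ∖ u) $ η v
        ≈⟨ LinearMap.cong b (homotopy-identity n (S ∖ u) v r (ℕ.≤-trans (∖-length u S) S≤n)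
             (∖-unique u (Unique-tail aS!)) q) ⟩
      b $ η v ∎
      where
      b h : LinearMap T T
      b = bracket a u
      h = homotopy n (S ∖ u)
      s = sign (a ∷ u)
      s*s* : ∀ t → s *ₗ (s *ₗ t) ≋ t
      s*s* t = ≈ᴹ-trans (≈ᴹ-sym (*ₗ-assoc s s t)) (≈ᴹ-trans (*ₗ-cong (sign² (a ∷ u)) ≈ᴹ-refl) (*ₗ-identityˡ t))
      ∂H : ∂ $ H $ b $ η v ≋ b $ ∂ $ h $ η v
      ∂H = begin
        ∂ $ H $ b $ η v              ≈⟨ LinearMap.cong ∂ (homotopy-bracket n a S x u′ a∉u (η v)) ⟩
        s *ₗ (∂ $ b $ h $ η v)       ≈⟨ *ₗ-cong R.refl (∂-bracket a x u′ (h $ η v)) ⟩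
        s *ₗ (s *ₗ (b $ ∂ $ h $ η v)) ≈⟨ s*s* _ ⟩
        b $ ∂ $ h $ η v              ∎
      H∂ : H $ ∂ $ b $ η v ≋ b $ h $ ∂ $ η v
      H∂ = begin
        H $ ∂ $ b $ η v              ≈⟨ LinearMap.cong H (∂-bracket a x u′ (η v)) ⟩
        s *ₗ (H $ b $ ∂ $ η v)       ≈⟨ *ₗ-cong R.refl (homotopy-bracket n a S x u′ a∉u (∂ $ η v)) ⟩
        s *ₗ (s *ₗ (b $ h $ ∂ $ η v)) ≈⟨ s*s* _ ⟩
        b $ h $ ∂ $ η v              ∎
      cycle-part : cycleₗ (a ∷ S) $ ρ $ b $ η v ≋ b $ cycleₗ (S ∖ u) $ critical n (S ∖ u) $ η v
      cycle-part = ≈ᴹ-trans (LinearMap.cong (cycleₗ (a ∷ S)) (critical-bracket n a S x u′ a∉u (η v)))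
        (cycleₗ-cons a S u (critical n (S ∖ u) $ η v))

-- Values of the homotopy, the projection and the cycles

module CriticalWords {c ℓ : Level} (R : CommutativeRing c ℓ) {V : Set} (_≟_ : DecidableEquality V) where
  open Modules R
  open LinearAlgebra R
  open InjectiveWords R _≟_
  open Removal _≟_
  open Expansion R _≟_
  open Homotopy R _≟_
  open Enumeration _≟_ using (Word; Code; Critical; []; _∷_)
  open T using (0ᴹ; ≈ᴹ-refl; ≈ᴹ-trans; *ₗ-cong; *ₗ-zeroʳ)
    renaming (_≈ᴹ_ to _≋_)

  -- The missing letter y stays missing in every step of the recursion, while a nonzero value could
  -- only arise at the empty alphabet, where no letter can be missing.
  critical-vanishes : ∀ n S w y r → length S ≤ n → Unique S → S ↭ w ++ y ∷ r →
    critical n S $ η w C.≈ᴹ C.0ᴹ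
  critical-vanishes n [] w y r _ _ p = contradiction (↭-trans (↭-sym (shift y w r)) (↭-sym p)) ¬x∷xs↭[]
  critical-vanishes (suc n) (a ∷ S) w y r (s≤s S≤n) aS! p = C.≈ᴹ-trans
    (expand-cong a C w
      (λ { []      v e → C.≈ᴹ-refl
         ; u@(_ ∷ _) v e → LinearMap.cong (consₗ u)
             (critical-vanishes n (S ∖ u) v y r (ℕ.≤-trans (∖-length u S) S≤n)
               (∖-unique u (Unique-tail aS!)) (proj₂ (proj₂ (split-prefix aS! p u e)))) })
      (λ _ → C.≈ᴹ-refl))
    (expand-linear a C w (zeroMap T C))

  -- The projection strips one bracket at a time. This left inverse is what makes the critical
  -- cycles independent.
  critical-cycle : ∀ n S {c} → length S ≤ n → Unique S → Critical S c →
    critical n S $ cycle-word S c C.≈ᴹ η c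
  critical-cycle n [] _ _ [] = C.≈ᴹ-refl
  critical-cycle (suc n) (a ∷ S) (s≤s S≤n) aS! (_∷_ {x = x} {u} {X} {c} p κ) = C.≈ᴹ-trans
    (critical-bracket n a S x u (λ a∈ → Unique[x∷xs]⇒x∉xs aS! (∈-resp-↭ (↭-sym p) (∈-++⁺ˡ a∈))) (cycle-word (S ∖ (x ∷ u)) c))
    (LinearMap.cong (consₗ (x ∷ u)) (critical-cycle n (S ∖ (x ∷ u)) (ℕ.≤-trans (∖-length (x ∷ u) S) S≤n)
      (∖-unique (x ∷ u) (Unique-tail aS!)) κ))

  ∂-cycle : ∀ {S c} → Critical S c → ∂ $ cycle-word S c ≋ 0ᴹ
  ∂-cycle [] = ≈ᴹ-refl
  ∂-cycle (_∷_ {a} {S} {x} {u} {c = c} p κ) = ≈ᴹ-trans (∂-bracket a x u (cycle-word (S ∖ (x ∷ u)) c))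
    (≈ᴹ-trans (*ₗ-cong R.refl (≈ᴹ-trans (LinearMap.cong (bracket a (x ∷ u)) (∂-cycle κ))
      (LinearMap.0-hom (bracket a (x ∷ u))))) (*ₗ-zeroʳ _))

  Words : Pred Word 0ℓ → Submodule T (c ⊔ ℓ)
  Words P = Span T {I = Σ Word P} λ (w , _) → η w

  bracket-∈ : ∀ {P : Pred Word 0ℓ} a u v → (∀ {w} → w ↭ a ∷ u ++ v → P w) →
    Submodule.Member (Words P) (bracket a u $ η v)
  bracket-∈ a []      v q = span-gen (a ∷ v , q ↭-refl)
  bracket-∈ {P} a (x ∷ u) v q = span-+
    -- P is known only for words that contain x, so the recursive call uses the predicate of being a
    -- rearrangement instead.
    (span-map (left x) (Words P) (λ (w , Pw) → span-gen (x ∷ w , q (↭-∷-∷ Pw)))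
      (bracket-∈ {_↭ a ∷ u ++ v} a u v λ e → e))
    (span-* (sign u) (bracket-∈ a u (x ∷ v) λ e → q (↭-trans e (prep a (shift x u v)))))

  ↭-block : ∀ {a : V} {S X v r w : Word} u → S ↭ u ++ X → X ↭ v ++ r → w ↭ a ∷ u ++ v → a ∷ S ↭ w ++ r
  ↭-block {a} {v = v} {r} u p q e = ↭-trans (prep a (↭-trans p (↭-trans (++⁺ˡ u q) (↭-sym (++-assoc u v r)))))
    (++⁺ʳ r (↭-sym e))

  ↭-block-length : ∀ {a : V} {v w : Word} u → w ↭ a ∷ u ++ v → length w ≡ suc (length u ℕ.+ length v)
  ↭-block-length u e = ≡.trans (↭-length e) (≡.cong suc (length-++ u))

  InjectiveWord : Word → ℕ → Pred Word 0ℓ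
  InjectiveWord S k w = length w ≡ k × ∃ λ r → S ↭ w ++ r

  -- The cone adds a letter that w lacks, and brackets only rearrange letters. This keeps fillings
  -- of regular chains regular.
  homotopy-∈ : ∀ n S w r → length S ≤ n → Unique S → S ↭ w ++ r →
    Submodule.Member (Words (InjectiveWord S (suc (length w)))) (homotopy n S $ η w)
  homotopy-∈ n [] w r _ _ p = span-0
  homotopy-∈ (suc n) (a ∷ S) w r (s≤s S≤n) aS! p =
    expand-∈ a T (Words (InjectiveWord (a ∷ S) (suc (length w)))) w present absent
    where
    present : ∀ u v → w ↭ a ∷ u ++ v → Submodule.Member (Words (InjectiveWord (a ∷ S) (suc (length w)))) (homotopyₖ n a S u v)
    present []        v e = span-0
    present u@(x ∷ u′) v e with _ , p′ , q ← split-prefix aS! p u e = span-* (sign (a ∷ u))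
      (span-map (bracket a u) (Words (InjectiveWord (a ∷ S) (suc (length w))))
        (λ (v′ , v′-length , r′ , q′) → bracket-∈ a u v′ λ e′ →
          (≡.trans (↭-block-length u e′) (≡.trans (≡.cong (λ k → suc (length u ℕ.+ k)) v′-length)
            (≡.trans (≡.cong suc (ℕ.+-suc (length u) (length v))) (≡.cong suc (≡.sym (↭-block-length u e))))))
          , r′ , ↭-block u p′ q′ e′)
        (homotopy-∈ n (S ∖ u) v r (ℕ.≤-trans (∖-length u S) S≤n) (∖-unique u (Unique-tail aS!)) q))
    absent : a ∉ w → Submodule.Member (Words (InjectiveWord (a ∷ S) (suc (length w)))) (η (a ∷ w))
    absent a∉w with r′ , e ← ∉⇒remainder aS! p a∉w =
      span-gen (a ∷ w , refl , r′ , ↭-trans p (↭-trans (++⁺ˡ w e) (shift a w r′)))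

  Codes : Word → Submodule C (c ⊔ ℓ)
  Codes S = Span C {I = Σ Code (Critical S)} λ (c , _) → η c

  critical-∈ : ∀ n S w r → length S ≤ n → Unique S → S ↭ w ++ r →
    Submodule.Member (Codes S) (critical n S $ η w)
  critical-∈ n [] w r _ _ p = span-gen ([] , [])
  critical-∈ (suc n) (a ∷ S) w r (s≤s S≤n) aS! p =
    expand-∈ a C (Codes (a ∷ S)) w present (λ _ → span-0)
    where
    present : ∀ u v → w ↭ a ∷ u ++ v → Submodule.Member (Codes (a ∷ S)) (criticalₖ n S u v)
    present []        v e = span-0
    present u@(x ∷ u′) v e with _ , p′ , q ← split-prefix aS! p u e =
      span-map (consₗ u) (Codes (a ∷ S)) (λ (c , κ) → span-gen (u ∷ c , p′ ∷ κ))
        (critical-∈ n (S ∖ u) v r (ℕ.≤-trans (∖-length u S) S≤n) (∖-unique u (Unique-tail aS!)) q)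

  cycle-∈ : ∀ {S c} → Unique S → Critical S c → Submodule.Member (Words (S ↭_)) (cycle-word S c)
  cycle-∈ _ [] = span-gen ([] , ↭-refl)
  cycle-∈ {a ∷ S} aS! (_∷_ {x = x} {u} {X} p κ) = span-map (bracket a (x ∷ u)) (Words (a ∷ S ↭_))
    (λ (v , q) → bracket-∈ a (x ∷ u) v λ e →
      ↭-trans (prep a (↭-trans p (++⁺ˡ (x ∷ u) (↭-trans (↭-sym (∖-↭ (x ∷ u) (Unique-tail aS!) p)) q)))) (↭-sym e))
    (cycle-∈ (∖-unique (x ∷ u) (Unique-tail aS!)) κ)

-- Finite sums and coordinates

lookup-injective : ∀ {A : Set} {xs : List A} → Unique xs → ∀ {i j} → lookup xs i ≡ lookup xs j → i ≡ j
lookup-injective {xs = x ∷ xs} (x∉ ∷ xs!) {zero}  {zero}  e = refl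
lookup-injective {xs = x ∷ xs} (x∉ ∷ xs!) {zero}  {suc j} e = contradiction e (All.lookup x∉ (∈-lookup j))
lookup-injective {xs = x ∷ xs} (x∉ ∷ xs!) {suc i} {zero}  e = contradiction (≡.sym e) (All.lookup x∉ (∈-lookup i))
lookup-injective {xs = x ∷ xs} (x∉ ∷ xs!) {suc i} {suc j} e = ≡.cong suc (lookup-injective xs! e)

module FiniteSums {c ℓ : Level} (R : CommutativeRing c ℓ) where
  open Modules R
  open LinearAlgebra R
  open R using (Carrier; _≈_; _*_; 0#; 1#; ring)

  Rₘ : LeftModule ring c ℓ
  Rₘ = TensorUnit.leftModule

  module _ {m ℓm} (M : LeftModule ring m ℓm) where
    open LeftModule M
    open CommutativeMonoidSum +ᴹ-commutativeMonoid using (sum; sum-remove; sum-cong-≋; sum-replicate-zero)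

    sum-single : ∀ {n} (f : Fin n → Carrierᴹ) j → (∀ i → i ≢ j → f i ≈ᴹ 0ᴹ) → sum f ≈ᴹ f j
    sum-single {suc n} f j p = ≈ᴹ-trans (sum-remove {n} {j} f) (≈ᴹ-trans
      (+ᴹ-congˡ (≈ᴹ-trans (sum-cong-≋ {n} λ i → p _ (Fin.punchInᵢ≢i j i)) (sum-replicate-zero n)))
      (+ᴹ-identityʳ _))

    line : Carrierᴹ → LinearMap Rₘ M
    line x = record
      { ⟦_⟧   = λ r → r *ₗ x
      ; cong  = λ e → *ₗ-cong e ≈ᴹ-refl
      ; +-hom = λ r s → *ₗ-distribʳ x r s
      ; *-hom = λ r s → *ₗ-assoc r s x
      }

  module _ {m ℓm n ℓn} {M : LeftModule ring m ℓm} {N : LeftModule ring n ℓn} where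
    private
      module M = LeftModule M
      module N = LeftModule N

    map-sum : (f : LinearMap M N) → ∀ {k} (x : Fin k → M.Carrierᴹ) →
      (f $ MonoidSum.sum M.+ᴹ-monoid x) N.≈ᴹ MonoidSum.sum N.+ᴹ-monoid (λ i → f $ x i)
    map-sum f {zero}  x = LinearMap.0-hom f
    map-sum f {suc k} x = N.≈ᴹ-trans (LinearMap.+-hom f _ _) (N.+ᴹ-congˡ (map-sum f (λ i → x (suc i))))

    sumₗ : ∀ {k} → (Fin k → LinearMap M N) → LinearMap M N
    sumₗ {zero}  f = zeroMap M N
    sumₗ {suc k} f = f zero +ₗ sumₗ (λ i → f (suc i))

    sumₗ-apply : ∀ {k} (f : Fin k → LinearMap M N) x →
      (sumₗ f $ x) N.≈ᴹ MonoidSum.sum N.+ᴹ-monoid (λ i → f i $ x)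
    sumₗ-apply {zero}  f x = N.≈ᴹ-refl
    sumₗ-apply {suc k} f x = N.+ᴹ-congˡ (sumₗ-apply (λ i → f (suc i)) x)

    span-ext : ∀ {i} {I : Set i} {g : I → M.Carrierᴹ} (f f′ : LinearMap M N) →
      (∀ j → (f $ g j) N.≈ᴹ (f′ $ g j)) → ∀ {t} → InSpan M g t → (f $ t) N.≈ᴹ (f′ $ t)
    span-ext f f′ p (span-gen j)    = p j
    span-ext f f′ p (span-resp e t) = N.≈ᴹ-trans (LinearMap.cong f (M.≈ᴹ-sym e))
      (N.≈ᴹ-trans (span-ext f f′ p t) (LinearMap.cong f′ e))
    span-ext f f′ p span-0          = N.≈ᴹ-trans (LinearMap.0-hom f) (N.≈ᴹ-sym (LinearMap.0-hom f′))
    span-ext f f′ p (span-+ s t)    = N.≈ᴹ-trans (LinearMap.+-hom f _ _)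
      (N.≈ᴹ-trans (N.+ᴹ-cong (span-ext f f′ p s) (span-ext f f′ p t)) (N.≈ᴹ-sym (LinearMap.+-hom f′ _ _)))
    span-ext f f′ p (span-* r t)    = N.≈ᴹ-trans (LinearMap.*-hom f r _)
      (N.≈ᴹ-trans (N.*ₗ-cong R.refl (span-ext f f′ p t)) (N.≈ᴹ-sym (LinearMap.*-hom f′ r _)))

  module Coordinates {X : Set} (_≟_ : DecidableEquality X) where
    open LeftModule (Free X)
    open MonoidSum +ᴹ-monoid using (sum)

    indicator : X → X → Carrier
    indicator x y with x ≟ y
    ... | yes _ = 1#
    ... | no  _ = 0#

    coordinate : X → LinearMap (Free X) Rₘ
    coordinate x = extend X Rₘ (indicator x)

    indicator-≡ : ∀ x → indicator x x ≈ 1#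
    indicator-≡ x with x ≟ x
    ... | yes _  = R.refl
    ... | no x≢x = contradiction refl x≢x

    indicator-≢ : ∀ {x y} → x ≢ y → indicator x y ≈ 0#
    indicator-≢ {x} {y} x≢y with x ≟ y
    ... | yes x≡y = contradiction x≡y x≢y
    ... | no _    = R.refl

    module _ {xs : List X} (xs! : Unique xs) where

      -- Both sides are linear in t, so it suffices to compare them on a generator, where only one
      -- summand survives.
      coordinate-spanning : ∀ {i} {I : Set i} {g : I → X} → (∀ i → g i ∈ xs) →
        ∀ {t} → InSpan (Free X) (λ i → η (g i)) t →
        t ≈ᴹ sum {length xs} λ i → (coordinate (lookup xs i) $ t) *ₗ η (lookup xs i)
      coordinate-spanning {g = g} g∈ {t} t∈ = ≈ᴹ-trans
        (span-ext idₗ (sumₗ expansion) onGenerator t∈) (sumₗ-apply expansion t)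
        where
        expansion : Fin (length xs) → LinearMap (Free X) (Free X)
        expansion i = line (Free X) (η (lookup xs i)) ∘ₗ coordinate (lookup xs i)
        onGenerator : ∀ j → η (g j) ≈ᴹ sumₗ expansion $ η (g j)
        onGenerator j with k ← Any.index (g∈ j) | e ← lookup-index (g∈ j) rewrite e = ≈ᴹ-sym (begin
          sumₗ expansion $ η (lookup xs k)
            ≈⟨ sumₗ-apply expansion (η (lookup xs k)) ⟩
          sum (λ i → indicator (lookup xs i) (lookup xs k) *ₗ η (lookup xs i))
            ≈⟨ sum-single (Free X) _ k (λ i i≢k → ≈ᴹ-trans
                 (*ₗ-cong (indicator-≢ λ e → i≢k (lookup-injective xs! e)) ≈ᴹ-refl) (*ₗ-zeroˡ _)) ⟩
          indicator (lookup xs k) (lookup xs k) *ₗ η (lookup xs k)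
            ≈⟨ ≈ᴹ-trans (*ₗ-cong (indicator-≡ (lookup xs k)) ≈ᴹ-refl) (*ₗ-identityˡ _) ⟩
          η (lookup xs k) ∎)
          where open SetoidReasoning ≈ᴹ-setoid

      coordinate-sum : ∀ (a : Fin (length xs) → Carrier) j →
        coordinate (lookup xs j) $ sum (λ i → a i *ₗ η (lookup xs i)) ≈ a j
      coordinate-sum a j = R.trans (map-sum (coordinate (lookup xs j)) (λ i → a i *ₗ η (lookup xs i)))
        (R.trans (sum-single Rₘ (λ i → a i * indicator (lookup xs j) (lookup xs i)) j λ i i≢j →
            R.trans (R.*-congˡ (indicator-≢ λ e → i≢j (≡.sym (lookup-injective xs! e)))) (R.zeroʳ _))
          (R.trans (R.*-congˡ (indicator-≡ (lookup xs j))) (R.*-identityʳ _)))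

-- Tuples of fixed length versus words

module Bridge {c ℓ : Level} (R : CommutativeRing c ℓ) {V : Set} (_≟_ : DecidableEquality V) where
  open Modules R
  open LinearAlgebra R
  open FiniteSums R
  open InjectiveWords R _≟_
  open Enumeration _≟_ using (Word)
  open Tuples V
  open R using (semiring)
  open SemiringExp semiring using (_^_)
  open T using (_*ₗ_; ≈ᴹ-sym; ≈ᴹ-trans; *ₗ-cong; +ᴹ-cong; +ᴹ-congˡ; *ₗ-assoc;
               +ᴹ-identityʳ; *ₗ-identityˡ; *ₗ-zeroʳ)
    renaming (_≈ᴹ_ to _≋_)
  open MonoidSum T.+ᴹ-monoid using (sum; sum-cong-≋)

  module K (k : ℕ) = LeftModule (Chains k)

  toWords : ∀ k → LinearMap (Chains k) T
  toWords k = extend (Vec V k) T λ x → η (toList x)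

  -- Words of the wrong length go to 0, which makes the inverse of `toWords` a linear map on all of
  -- `T` without length proofs.
  fit : ∀ k → Word → LeftModule.Carrierᴹ (Chains k)
  fit zero    []      = η []
  fit zero    (_ ∷ _) = K.0ᴹ 0
  fit (suc k) []      = K.0ᴹ (suc k)
  fit (suc k) (x ∷ w) = extend (Vec V k) (Chains (suc k)) (λ y → η (x ∷ y)) $ fit k w

  fromWords : ∀ k → LinearMap T (Chains k)
  fromWords k = extend Word (Chains k) (fit k)

  fit-toList : ∀ {k} (x : Vec V k) → K._≈ᴹ_ k (fit k (toList x)) (η x)
  fit-toList []      = K.≈ᴹ-refl 0
  fit-toList {suc k} (v ∷ x) = LinearMap.cong (extend (Vec V k) (Chains (suc k)) (λ y → η (v ∷ y))) (fit-toList x)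

  fromWords-toWords : ∀ k t → K._≈ᴹ_ k (fromWords k $ toWords k $ t) t
  fromWords-toWords k = ext (Vec V k) (fromWords k ∘ₗ toWords k) idₗ fit-toList

  private
    faces : ∀ {k} → Vec V (suc k) → Fin (suc k) → T.Carrierᴹ
    faces x i = (-1# ^ toℕ i) *ₗ η (toList (removeAt x i))

    sum-faces : ∀ {k} (x : Vec V (suc k)) → sum (faces x) ≋ ∂-word (toList x)
    sum-faces (v ∷ [])          = +ᴹ-cong (*ₗ-identityˡ _) (≈ᴹ-sym (*ₗ-zeroʳ -1#))
    sum-faces {suc k} (v ∷ y@(_ ∷ _)) = +ᴹ-cong (*ₗ-identityˡ _) (begin
      sum (λ i → faces (v ∷ y) (suc i))
        ≈⟨ sum-cong-≋ {suc k} (λ i → *ₗ-assoc -1# (-1# ^ toℕ i) (η (v ∷ toList (removeAt y i)))) ⟩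
      sum (λ i → -1# *ₗ (left v $ faces y i))
        ≈⟨ map-sum (-1# ·ₗ left v) (faces y) ⟨
      -1# *ₗ (left v $ sum (faces y))
        ≈⟨ *ₗ-cong R.refl (LinearMap.cong (left v) (sum-faces y)) ⟩
      -1# *ₗ (left v $ ∂-word (toList y)) ∎)
      where open SetoidReasoning T.≈ᴹ-setoid

  toWords-delete : ∀ k t → toWords k $ delete k $ t ≋ ∂ $ toWords (suc k) $ t
  toWords-delete k = ext (Vec V (suc k)) (toWords k ∘ₗ delete k) (∂ ∘ₗ toWords (suc k)) λ x →
    ≈ᴹ-trans (map-sum (toWords k) {suc k} λ i → (-1# ^ toℕ i) *ₗ′ η (removeAt x i)) (sum-faces x)
    where open LeftModule (Chains k) using () renaming (_*ₗ_ to _*ₗ′_)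

  -- On words, the augmentation is the boundary into length 0. Degree 0 thus needs no separate
  -- homotopy.
  toWords-augmentation : ∀ t → (augmentation $ t) *ₗ η [] ≋ ∂ $ toWords 1 $ t
  toWords-augmentation = ext (Vec V 1) (line T (η []) ∘ₗ augmentation) (∂ ∘ₗ toWords 1) λ { (x ∷ []) →
    ≈ᴹ-trans (*ₗ-identityˡ _) (≈ᴹ-sym (≈ᴹ-trans (+ᴹ-congˡ (*ₗ-zeroʳ -1#)) (+ᴹ-identityʳ _))) }

-- Injective words and strongly regular tuples

module _ {A : Set} where
  unique⇒↭ : ∀ {w S : List A} → Unique w → (∀ {x} → x ∈ w → x ∈ S) → ∃ λ r → S ↭ w ++ r
  unique⇒↭ {[]}    {S} _  w⊆S = S , ↭-refl
  unique⇒↭ {x ∷ w} {S} w! w⊆S =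
    let X , p = ∈⇒↭ (w⊆S (here refl))
        r , q = unique⇒↭ {w} {X} (Unique-tail w!) λ y∈ → tail-∈ (∈-resp-↭ p (w⊆S (there y∈))) y∈
    in r , ↭-trans p (prep x q)
    where
    tail-∈ : ∀ {y X} → y ∈ x ∷ X → y ∈ w → y ∈ X
    tail-∈ (here refl) y∈w = contradiction y∈w (Unique[x∷xs]⇒x∉xs w!)
    tail-∈ (there y∈X) _   = y∈X

  toList-unique : ∀ {k} {x : Vec A k} → UniqueVec x → Unique (toList x)
  toList-unique VecAllPairs.[]         = []
  toList-unique (v∉ VecAllPairs.∷ x!) = VecAll.toList⁺ v∉ ∷ toList-unique x!

  fromList-unique : ∀ {w : List A} → Unique w → UniqueVec (fromList w)
  fromList-unique []         = VecAllPairs.[]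
  fromList-unique (v∉ ∷ w!) = VecAll.fromList⁺ v∉ VecAllPairs.∷ fromList-unique w!

  -- Completeness of the graph enters here: its edges are inequalities, so strongly regular tuples
  -- are allowed.
  unique⇒linked : ∀ {k} {x : Vec A k} → UniqueVec x → Linked _≢_ x
  unique⇒linked VecAllPairs.[] = []
  unique⇒linked (_ VecAllPairs.∷ VecAllPairs.[]) = [-]
  unique⇒linked ((v≢ VecAll.∷ _) VecAllPairs.∷ x!@(_ VecAllPairs.∷ _)) = v≢ ∷ unique⇒linked x!

  unique-prefix : ∀ w {r : List A} → Unique (w ++ r) → Unique w
  unique-prefix []      _         = []
  unique-prefix (x ∷ w) (x∉ ∷ u) = All.tabulate (λ y∈ → All.lookup x∉ (∈-++⁺ˡ y∈)) ∷ unique-prefix w u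

-- The regular path complex of the complete graph

module CompleteGraph {c ℓ : Level} (R : CommutativeRing c ℓ) (n : ℕ) where
  open Modules R
  open LinearAlgebra R
  open FiniteSums R
  open InjectiveWords R (Fin._≟_ {n})
  open Homotopy R (Fin._≟_ {n})
  open CriticalWords R (Fin._≟_ {n})
  open Enumeration (Fin._≟_ {n})
    using (Word; Code; Critical; closed; closed-sound; closed-complete; closed-unique; closed-length)
  open Bridge R (Fin._≟_ {n})
  open Tuples (Fin n)
  open RegularPathHomology (complete n) hiding (∂)
  open R using (Carrier; _≈_; 0#; 1#)

  S₀ : Word
  S₀ = allFin n

  S₀-length : length S₀ ≡ n
  S₀-length = List.length-tabulate (λ i → i)

  S₀≤n : length S₀ ≤ n
  S₀≤n = ℕ.≤-reflexive S₀-length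

  h : LinearMap T T
  h = homotopy n S₀

  ρ : LinearMap T C
  ρ = critical n S₀

  β : LinearMap C T
  β = cycleₗ S₀

  RegularTuple : ℕ → Set
  RegularTuple k = Σ (Vec (Fin n) k) λ x → StronglyRegular (complete n) x × Allowed (complete n) x

  -- 𝒜′ (suc m) is 𝒜 m.
  𝒜′ : ∀ k → Submodule (Chains k) (c ⊔ ℓ)
  𝒜′ k = Span (Chains k) {I = RegularTuple k} λ (x , _) → η x

  regular⇒injective : ∀ {k} {x : Vec (Fin n) k} → UniqueVec x → InjectiveWord S₀ k (toList x)
  regular⇒injective {x = x} x! = Vec.length-toList x , unique⇒↭ (toList-unique x!) λ _ → ∈-allFin _

  toWords-∈ : ∀ k {z} → Submodule.Member (𝒜′ k) z → Submodule.Member (Words (InjectiveWord S₀ k)) (toWords k $ z)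
  toWords-∈ k = span-map (toWords k) (Words (InjectiveWord S₀ k)) λ (x , x! , _) → span-gen (toList x , regular⇒injective x!)

  injective⇒regular : ∀ {k w} → InjectiveWord S₀ k w → Σ (RegularTuple k) λ (x , _) → toList x ≡ w
  injective⇒regular {w = w} (refl , r , p) =
    (fromList w , w! , unique⇒linked w!) , Vec.toList∘fromList w
    where w! = fromList-unique (unique-prefix w (Unique-resp p (allFin⁺ n)))

  fromWords-∈ : ∀ k {t} → Submodule.Member (Words (InjectiveWord S₀ k)) t → Submodule.Member (𝒜′ k) (fromWords k $ t)
  fromWords-∈ k = span-map (fromWords k) (𝒜′ k) generator
    where
    generator : ((w , _) : Σ Word (InjectiveWord S₀ k)) → Submodule.Member (𝒜′ k) (fit k w)
    generator (w , w∈) with x , refl ← injective⇒regular w∈ =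
      span-resp (LeftModule.≈ᴹ-sym (Chains k) (fit-toList (proj₁ x))) (span-gen x)

  toWords-fromWords : ∀ k {t} → Submodule.Member (Words (InjectiveWord S₀ k)) t → toWords k $ fromWords k $ t T.≈ᴹ t
  toWords-fromWords k = span-ext (toWords k ∘ₗ fromWords k) idₗ generator
    where
    generator : ((w , _) : Σ Word (InjectiveWord S₀ k)) → toWords k $ fit k w T.≈ᴹ η w
    generator (w , w∈) with (x , _) , refl ← injective⇒regular w∈ = LinearMap.cong (toWords k) (fit-toList x)

  -- Obtained by conjugating `toWords-delete`, so faces are computed in one direction only.
  fromWords-∂ : ∀ k {t} → Submodule.Member (Words (InjectiveWord S₀ (suc k))) t →
    LeftModule._≈ᴹ_ (Chains k) (fromWords k $ ∂ $ t) (delete k $ fromWords (suc k) $ t)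
  fromWords-∂ k {t} t∈ = begin
    fromWords k $ ∂ $ t
      ≈⟨ LinearMap.cong (fromWords k) (LinearMap.cong ∂ (toWords-fromWords (suc k) t∈)) ⟨
    fromWords k $ ∂ $ toWords (suc k) $ fromWords (suc k) $ t
      ≈⟨ LinearMap.cong (fromWords k) (toWords-delete k (fromWords (suc k) $ t)) ⟨
    fromWords k $ toWords k $ delete k $ fromWords (suc k) $ t
      ≈⟨ fromWords-toWords k _ ⟩
    delete k $ fromWords (suc k) $ t ∎
    where open SetoidReasoning (LeftModule.≈ᴹ-setoid (Chains k))

  h-∈ : ∀ k {t} → Submodule.Member (Words (InjectiveWord S₀ k)) t →
    Submodule.Member (Words (InjectiveWord S₀ (suc k))) (h $ t)
  h-∈ k = span-map h (Words (InjectiveWord S₀ (suc k))) λ { (w , refl , r , p) →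
    homotopy-∈ n S₀ w r S₀≤n (allFin⁺ n) p }

  ρ-∈ : ∀ k {t} → Submodule.Member (Words (InjectiveWord S₀ k)) t → Submodule.Member (Codes S₀) (ρ $ t)
  ρ-∈ k = span-map ρ (Codes S₀) λ (w , _ , r , p) → critical-∈ n S₀ w r S₀≤n (allFin⁺ n) p

  ρ-vanishes : ∀ {k} → k < n → ∀ {t} → Submodule.Member (Words (InjectiveWord S₀ k)) t → ρ $ t C.≈ᴹ C.0ᴹ
  ρ-vanishes k<n = span-ext ρ (zeroMap T C) λ where
    (w , refl , []    , p) → contradiction
      (≡.trans (≡.sym (↭-length (↭-trans p (++-identityʳ w)))) S₀-length) (ℕ.<⇒≢ k<n)
    (w , refl , y ∷ r , p) → critical-vanishes n S₀ w y r S₀≤n (allFin⁺ n) p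

  -- By counting letters there is no injective tuple of length k, so the generating family is empty.
  𝒜-vanishes : ∀ {k} → n < k → ∀ {z} → Submodule.Member (𝒜′ k) z →
    LeftModule._≈ᴹ_ (Chains k) z (LeftModule.0ᴹ (Chains k))
  𝒜-vanishes {k} n<k = span-ext idₗ (zeroMap (Chains k) (Chains k)) λ (x , x! , _) →
    let l , r , p = regular⇒injective x!
    in contradiction (≡.subst₂ _≤_ l S₀-length (ℕ.≤-trans
         (ℕ.≤-trans (ℕ.m≤m+n (length (toList x)) (length r)) (ℕ.≤-reflexive (≡.sym (List.length-++ (toList x)))))
         (ℕ.≤-reflexive (≡.sym (↭-length p))))) (ℕ.<⇒≱ n<k)

  filling : ∀ k → LinearMap (Chains k) (Chains (suc k))
  filling k = fromWords (suc k) ∘ₗ (h ∘ₗ toWords k)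

  criticalPart : ∀ k → LinearMap (Chains k) (Chains k)
  criticalPart k = (fromWords k ∘ₗ β) ∘ₗ (ρ ∘ₗ toWords k)

  module _ (k : ℕ) {z} (z∈ : Submodule.Member (𝒜′ k) z) where
    open LeftModule (Chains k)
    open SetoidReasoning ≈ᴹ-setoid

    filling-∈ : Submodule.Member (𝒜′ (suc k)) (filling k $ z)
    filling-∈ = fromWords-∈ (suc k) (h-∈ k (toWords-∈ k z∈))

    -- The homotopy identity read back in tuples; on a cycle the middle term h ∂ drops out.
    cycle-decomposition : ∂ $ toWords k $ z T.≈ᴹ T.0ᴹ →
      z ≈ᴹ (delete k $ filling k $ z) +ᴹ (criticalPart k $ z)
    cycle-decomposition ∂z≈0 = begin
      z
        ≈⟨ fromWords-toWords k z ⟨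
      fromWords k $ t
        ≈⟨ LinearMap.cong (fromWords k) (span-ext (homotopy-identityₗ n S₀) idₗ
             (λ (w , _ , r , p) → homotopy-identity n S₀ w r S₀≤n (allFin⁺ n) p) t∈) ⟨
      fromWords k $ homotopy-identityₗ n S₀ $ t
        ≡⟨⟩
      ((fromWords k $ ∂ $ h $ t) +ᴹ (fromWords k $ h $ ∂ $ t)) +ᴹ (criticalPart k $ z)
        ≈⟨ +ᴹ-congʳ (+ᴹ-cong (fromWords-∂ k (h-∈ k t∈))
             (≈ᴹ-trans (LinearMap.cong (fromWords k ∘ₗ h) ∂z≈0) (LinearMap.0-hom (fromWords k ∘ₗ h)))) ⟩
      ((delete k $ filling k $ z) +ᴹ 0ᴹ) +ᴹ (criticalPart k $ z)
        ≈⟨ +ᴹ-congʳ (+ᴹ-identityʳ _) ⟩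
      (delete k $ filling k $ z) +ᴹ (criticalPart k $ z) ∎
      where
      t = toWords k $ z
      t∈ = toWords-∈ k z∈

    filling-boundary : k ≢ n → ∂ $ toWords k $ z T.≈ᴹ T.0ᴹ → z ≈ᴹ delete k $ filling k $ z
    filling-boundary k≢n ∂z≈0 with ℕ.<-cmp k n
    ... | tri≈ _ k≡n _ = contradiction k≡n k≢n
    ... | tri< k<n _ _ = ≈ᴹ-trans (cycle-decomposition ∂z≈0) (≈ᴹ-trans
      (+ᴹ-congˡ (≈ᴹ-trans (LinearMap.cong (fromWords k ∘ₗ β) (ρ-vanishes k<n (toWords-∈ k z∈)))
                          (LinearMap.0-hom (fromWords k ∘ₗ β))))
      (+ᴹ-identityʳ _))
    ... | tri> _ _ n<k = ≈ᴹ-trans (𝒜-vanishes n<k z∈) (≈ᴹ-sym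
      (≈ᴹ-trans (LinearMap.cong (delete k ∘ₗ filling k) (𝒜-vanishes n<k z∈))
                (LinearMap.0-hom (delete k ∘ₗ filling k))))

  codes : List Code
  codes = closed n S₀

  codes-length : length codes ≡ subfactorial n
  codes-length = ≡.trans (closed-length n S₀≤n (allFin⁺ n)) (≡.cong subfactorial S₀-length)

  code : Fin (length codes) → Code
  code = lookup codes

  code-critical : ∀ i → Critical S₀ (code i)
  code-critical i = closed-sound n S₀≤n (allFin⁺ n) (∈-lookup i)

  open Coordinates (List.≡-dec (List.≡-dec (Fin._≟_ {n})))

  codes! : Unique codes
  codes! = closed-unique n S₀≤n (allFin⁺ n)

  cycle : Fin (length codes) → T.Carrierᴹ
  cycle i = cycle-word S₀ (code i)

  cycle-injective : ∀ i → Submodule.Member (Words (InjectiveWord S₀ n)) (cycle i)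
  cycle-injective i = span-map idₗ (Words (InjectiveWord S₀ n))
    (λ (w , p) → span-gen (w , ≡.trans (≡.sym (↭-length p)) S₀-length , [] , ↭-trans p (↭-sym (++-identityʳ w))))
    (cycle-∈ (allFin⁺ n) (code-critical i))

  basis : Fin (length codes) → LeftModule.Carrierᴹ (Chains n)
  basis i = fromWords n $ cycle i

  basis-∈ : ∀ i → Submodule.Member (𝒜′ n) (basis i)
  basis-∈ i = fromWords-∈ n (cycle-injective i)

  toWords-basis : ∀ i → toWords n $ basis i T.≈ᴹ cycle i
  toWords-basis i = toWords-fromWords n (cycle-injective i)

  ∂-basis : ∀ i → ∂ $ toWords n $ basis i T.≈ᴹ T.0ᴹ
  ∂-basis i = T.≈ᴹ-trans (LinearMap.cong ∂ (toWords-basis i)) (∂-cycle (code-critical i))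

  module _ where
    open LeftModule (Chains n)
    open MonoidSum +ᴹ-monoid using (sum)

    coefficient : Fin (length codes) → LinearMap (Chains n) Rₘ
    coefficient i = coordinate (code i) ∘ₗ (ρ ∘ₗ toWords n)

    criticalPart-basis : ∀ {z} → Submodule.Member (𝒜′ n) z →
      criticalPart n $ z ≈ᴹ sum λ i → (coefficient i $ z) *ₗ basis i
    criticalPart-basis {z} z∈ = ≈ᴹ-trans
      (LinearMap.cong (fromWords n ∘ₗ β) (coordinate-spanning codes! (λ (c , κ) → closed-complete n S₀≤n (allFin⁺ n) κ)
        (ρ-∈ n (toWords-∈ n z∈))))
      (map-sum (fromWords n ∘ₗ β) {length codes} (λ i → LeftModule._*ₗ_ C (coefficient i $ z) (η (code i))))

    -- The projection followed by a coordinate sends each basis cycle to its own code, and so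
    -- extracts its coefficient.
    basis-independent : ∀ a → sum (λ i → a i *ₗ basis i) ≈ᴹ 0ᴹ → ∀ j → a j ≈ 0#
    basis-independent a Σ≈0 j = R.trans (R.sym (R.trans
      (LinearMap.cong (coordinate (code j)) ρΣ) (coordinate-sum codes! a j)))
      (R.trans (LinearMap.cong (coefficient j) Σ≈0) (LinearMap.0-hom (coefficient j)))
      where
      ρΣ : ρ $ toWords n $ sum (λ i → a i *ₗ basis i) C.≈ᴹ
           MonoidSum.sum C.+ᴹ-monoid (λ i → LeftModule._*ₗ_ C (a i) (η (code i)))
      ρΣ = C.≈ᴹ-trans (map-sum (ρ ∘ₗ toWords n) {length codes} (λ i → a i *ₗ basis i))
        (MonoidSum.sum-cong-≋ C.+ᴹ-monoid {length codes} λ i → C.≈ᴹ-trans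
          (LinearMap.*-hom (ρ ∘ₗ toWords n) (a i) (basis i)) (C.*ₗ-cong (R.refl {a i})
          (C.≈ᴹ-trans (LinearMap.cong ρ (toWords-basis i)) (critical-cycle n S₀ S₀≤n (allFin⁺ n) (code-critical i)))))

  module Hₘ (m : ℕ) = LeftModule (ReducedHomology (+ m))

  -- Degree 0 is cut out by the augmentation and higher degrees by ∂, so their carriers differ. This
  -- accessor and the lemmas on it confine that case split.
  chain : ∀ m → Hₘ.Carrierᴹ m → LeftModule.Carrierᴹ (Λ m)
  chain zero    ((z , _) , _) = z
  chain (suc m) ((z , _) , _) = z

  chain-∈ : ∀ m x → Submodule.Member (𝒜 m) (chain m x)
  chain-∈ zero    ((_ , z∈)     , _) = z∈
  chain-∈ (suc m) ((_ , z∈ , _) , _) = z∈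

  chain-cycle : ∀ m x → ∂ $ toWords (suc m) $ chain m x T.≈ᴹ T.0ᴹ
  chain-cycle zero    ((z , _) , εz≈0) = T.≈ᴹ-trans (T.≈ᴹ-sym (toWords-augmentation z))
    (T.≈ᴹ-trans (T.*ₗ-cong εz≈0 T.≈ᴹ-refl) (T.*ₗ-zeroˡ _))
  chain-cycle (suc m) ((z , _) , ∂z≈0) = T.≈ᴹ-trans (T.≈ᴹ-sym (toWords-delete (suc m) z))
    (LinearMap.cong (toWords (suc m)) ∂z≈0)

  fromCycle : ∀ m {z} → Submodule.Member (𝒜 m) z → ∂ $ toWords (suc m) $ z T.≈ᴹ T.0ᴹ → ∃ λ x → chain m x ≡ z
  fromCycle zero {z} z∈ ∂z≈0 = ((z , z∈) , εz≈0) , refl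
    where
    -- Any functional with value 1 at the empty word recovers the augmentation of z from its
    -- multiple of `η []`.
    total : LinearMap T Rₘ
    total = extend Word Rₘ λ _ → 1#
    εz≈0 : augmentation $ z ≈ 0#
    εz≈0 = R.trans (R.sym (R.*-identityʳ _)) (LinearMap.cong total (T.≈ᴹ-trans (toWords-augmentation z) ∂z≈0))
  fromCycle (suc m) {z} z∈ ∂z≈0 =
    ((z , z∈ , Submodule.resp (𝒜 m) (LeftModule.≈ᴹ-sym (Λ m) δz≈0) (Submodule.0∈ (𝒜 m))) , δz≈0) , refl
    where
    open LeftModule (Λ m)
    δz≈0 : (delete (suc m) $ z) ≈ᴹ 0ᴹ
    δz≈0 = ≈ᴹ-trans (≈ᴹ-sym (fromWords-toWords (suc m) _))
      (LinearMap.cong (fromWords (suc m)) (T.≈ᴹ-trans (toWords-delete (suc m) z) ∂z≈0))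

  -- Membership of w in `Ω` comes for free: its boundary is a difference of regular allowed chains.
  homologous⁺ : ∀ m x y {w} → Submodule.Member (𝒜 (suc m)) w →
    let open LeftModule (Λ m) in
    chain m x +ᴹ -ᴹ chain m y ≈ᴹ (delete (suc m) $ w) → Hₘ._≈ᴹ_ m x y
  homologous⁺ zero x y {w} w∈ e = (w , w∈ , Submodule.resp (𝒜 0) e
    (Submodule.+∈ (𝒜 0) (chain-∈ 0 x) (Submodule.neg∈ (𝒜 0) (chain-∈ 0 y)))) , e
  homologous⁺ (suc m) x y {w} w∈ e = (w , w∈ , Submodule.resp (𝒜 (suc m)) e
    (Submodule.+∈ (𝒜 (suc m)) (chain-∈ (suc m) x) (Submodule.neg∈ (𝒜 (suc m)) (chain-∈ (suc m) y)))) , e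

  homologous⁻ : ∀ m x y → Hₘ._≈ᴹ_ m x y →
    let open LeftModule (Λ m) in
    ∃ λ w → Submodule.Member (𝒜 (suc m)) w × chain m x +ᴹ -ᴹ chain m y ≈ᴹ (delete (suc m) $ w)
  homologous⁻ zero    x y ((w , w∈ , _) , e) = w , w∈ , e
  homologous⁻ (suc m) x y ((w , w∈ , _) , e) = w , w∈ , e

  chain-sum : ∀ m {r} (a : Fin r → Carrier) (x : Fin r → Hₘ.Carrierᴹ m) →
    let open LeftModule (Λ m) in
    chain m (MonoidSum.sum (Hₘ.+ᴹ-monoid m) λ i → Hₘ._*ₗ_ m (a i) (x i)) ≡
    MonoidSum.sum +ᴹ-monoid λ i → a i *ₗ chain m (x i)
  chain-sum zero    {zero}  a x = refl
  chain-sum (suc m) {zero}  a x = refl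
  chain-sum zero    {suc r} a x = ≡.cong (λ s → LeftModule._+ᴹ_ (Λ 0) _ s)
    (chain-sum zero (λ i → a (suc i)) (λ i → x (suc i)))
  chain-sum (suc m) {suc r} a x = ≡.cong (λ s → LeftModule._+ᴹ_ (Λ (suc m)) _ s)
    (chain-sum (suc m) (λ i → a (suc i)) (λ i → x (suc i)))

  chain-0 : ∀ m → chain m (Hₘ.0ᴹ m) ≡ LeftModule.0ᴹ (Λ m)
  chain-0 zero    = refl
  chain-0 (suc m) = refl

  acyclic : ∀ m → suc m ≢ n → IsZero (ReducedHomology (+ m))
  acyclic m m≢n x = homologous⁺ m x (Hₘ.0ᴹ m) (filling-∈ (suc m) (chain-∈ m x)) (begin
    chain m x +ᴹ -ᴹ chain m (Hₘ.0ᴹ m)  ≡⟨ ≡.cong (λ z → chain m x +ᴹ -ᴹ z) (chain-0 m) ⟩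
    chain m x +ᴹ -ᴹ 0ᴹ                 ≈⟨ ≈ᴹ-trans (+ᴹ-congˡ -ᴹ0≈0) (+ᴹ-identityʳ _) ⟩
    chain m x                          ≈⟨ filling-boundary (suc m) (chain-∈ m x) m≢n (chain-cycle m x) ⟩
    delete (suc m) $ filling (suc m) $ chain m x ∎)
    where
    open LeftModule (Λ m)
    open ModuleProperties (Λ m) using (-ᴹ0≈0)
    open SetoidReasoning ≈ᴹ-setoid

-- The top degree and the conclusion

module Top {c ℓ : Level} (R : CommutativeRing c ℓ) (m : ℕ) where
  open Modules R
  open LinearAlgebra R
  open CompleteGraph R (suc m)
  open Tuples (Fin (suc m))
  open RegularPathHomology (complete (suc m)) hiding (∂)
  open LeftModule (Λ m)
  open SetoidReasoning ≈ᴹ-setoid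
  open ModuleProperties (Λ m) using (-ᴹ0≈0)
  open R using (Carrier; _≈_; 0#)
  private module H = LeftModule (ReducedHomology (+ m))

  generator : ∀ i → ∃ λ x → chain m x ≡ basis i
  generator i = fromCycle m (basis-∈ i) (∂-basis i)

  generatorClass : Fin (length codes) → H.Carrierᴹ
  generatorClass i = proj₁ (generator i)

  chain-combination : ∀ a → chain m (MonoidSum.sum H.+ᴹ-monoid λ i → a i H.*ₗ generatorClass i) ≈ᴹ
    MonoidSum.sum +ᴹ-monoid λ i → a i *ₗ basis i
  chain-combination a = begin
    chain m (MonoidSum.sum H.+ᴹ-monoid λ i → a i H.*ₗ generatorClass i)
      ≡⟨ chain-sum m a generatorClass ⟩
    MonoidSum.sum +ᴹ-monoid (λ i → a i *ₗ chain m (generatorClass i))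
      ≈⟨ MonoidSum.sum-cong-≋ +ᴹ-monoid {length codes} (λ i → *ₗ-cong R.refl
           (≡.subst (chain m (generatorClass i) ≈ᴹ_) (proj₂ (generator i)) ≈ᴹ-refl)) ⟩
    MonoidSum.sum +ᴹ-monoid (λ i → a i *ₗ basis i) ∎

  top-free : IsFreeOfRank (ReducedHomology (+ m)) (length codes)
  top-free = generatorClass , record { spanning = spanning ; independent = independent }
    where
    spanning : ∀ x → ∃ λ (a : Fin (length codes) → Carrier) →
      x H.≈ᴹ MonoidSum.sum H.+ᴹ-monoid λ i → a i H.*ₗ generatorClass i
    -- The coefficients are the code coordinates of the projection of z; the remaining difference is
    -- the boundary of the filling.
    spanning x = a , homologous⁺ m x _ (filling-∈ (suc m) (chain-∈ m x)) (begin
      z +ᴹ -ᴹ chain m (MonoidSum.sum H.+ᴹ-monoid λ i → a i H.*ₗ generatorClass i)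
        ≈⟨ +ᴹ-cong (cycle-decomposition (suc m) (chain-∈ m x) (chain-cycle m x))
             (-ᴹ‿cong (≈ᴹ-trans (chain-combination a) (≈ᴹ-sym (criticalPart-basis (chain-∈ m x))))) ⟩
      ((delete (suc m) $ filling (suc m) $ z) +ᴹ (criticalPart (suc m) $ z)) +ᴹ -ᴹ (criticalPart (suc m) $ z)
        ≈⟨ ≈ᴹ-trans (+ᴹ-assoc _ _ _) (≈ᴹ-trans (+ᴹ-congˡ (-ᴹ‿inverseʳ _)) (+ᴹ-identityʳ _)) ⟩
      delete (suc m) $ filling (suc m) $ z ∎)
      where
      z = chain m x
      a : Fin (length codes) → Carrier
      a i = coefficient i $ z

    independent : ∀ a → MonoidSum.sum H.+ᴹ-monoid (λ i → a i H.*ₗ generatorClass i) H.≈ᴹ H.0ᴹ →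
      ∀ i → a i ≈ 0#
    independent a e with w , w∈ , e′ ← homologous⁻ m (MonoidSum.sum H.+ᴹ-monoid λ i → a i H.*ₗ generatorClass i) H.0ᴹ e =
      basis-independent a (begin
        MonoidSum.sum +ᴹ-monoid (λ i → a i *ₗ basis i)
          ≈⟨ chain-combination a ⟨
        s
          ≈⟨ ≈ᴹ-trans (+ᴹ-congˡ -ᴹ0≈0) (+ᴹ-identityʳ _) ⟨
        s +ᴹ -ᴹ 0ᴹ
          ≡⟨ ≡.cong (λ z → s +ᴹ -ᴹ z) (chain-0 m) ⟨
        s +ᴹ -ᴹ chain m H.0ᴹ
          ≈⟨ e′ ⟩
        delete (suc m) $ w
          -- The chain w consists of tuples of length m + 2 on m + 1 vertices and is therefore 0: a
          -- relation between top classes holds already between cycles.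
          ≈⟨ LinearMap.cong (delete (suc m)) (𝒜-vanishes ℕ.≤-refl w∈) ⟩
        delete (suc m) $ LeftModule.0ᴹ (Λ (suc m))
          ≈⟨ LinearMap.0-hom (delete (suc m)) ⟩
        0ᴹ ∎)
      where s = chain m (MonoidSum.sum H.+ᴹ-monoid λ i → a i H.*ₗ generatorClass i)

  -- The scalar r is the augmentation of r times the vertex `zero`, which exists because the graph
  -- has `suc m` vertices.
  augmentation-onto : IsZero (ReducedHomology -[1+ 0 ])
  augmentation-onto (r , _) = (LeftModule._*ₗ_ (Chains 1) r (η (zero ∷ [])) ,
      span-* r (span-gen ((zero ∷ []) , (VecAll.[] VecAllPairs.∷ VecAllPairs.[]) , [-]))) ,
    R.trans (R.+-congˡ -0≈0) (R.trans (R.+-identityʳ r) (R.sym (R.*-identityʳ r)))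
    where open ModuleProperties R-module using () renaming (-ᴹ0≈0 to -0≈0)

corollary5p19 : ∀ {c ℓ} (R : CommutativeRing c ℓ) →
    let module R = CommutativeRing R
        open Modules R
        open RegularPathHomology
    in ¬ (R.1# R.≈ R.0#) →
    ∀ (n : ℕ) → 1 ≤ n →
    (∀ d → d ≢ + n - + 1 → IsZero (ReducedHomology (complete n) d))
    × (∃[ r ] (+ r ≡ D n)
    × Inverse (setoid (Fin r)) (Derangements n)
    × IsFreeOfRank (ReducedHomology (complete n) (+ n - + 1)) r)
corollary5p19 R _ (suc m) _ = vanishing ,
    (subfactorial (suc m) , DerangementNumbers.subfactorial≡D (suc m) , CountDerangements.Fin↔Derangements (suc m) ,
     ≡.subst (IsFreeOfRank (ReducedHomology (complete (suc m)) (+ m))) codes-length top-free)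
  where
  open Modules R
  open RegularPathHomology
  open CompleteGraph R (suc m)
  open Top R m
  vanishing : ∀ d → d ≢ + m → IsZero (ReducedHomology (complete (suc m)) d)
  vanishing (+ k)         d≢ = acyclic k λ e → d≢ (≡.cong +_ (ℕ.suc-injective e))
  vanishing -[1+ zero ]   _  = augmentation-onto
  vanishing -[1+ suc _ ]  _  = λ _ → _
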